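{- Let $k\ge 3$. If $G$ is a finite $k$-regular graph with (vertex) connectivity $2$, then $G$ is $k$-swappable.
   Context: A list-assignment $L$ assigns to each vertex $v$ a set $L(v)$ of colors; an $L$-coloring is a proper coloring $\varphi$ with $\varphi(v)\in L(v)$. An $\alpha,\beta$-Kempe swap at a vertex $u$ with $\varphi(u)\in\{\alpha,\beta\}$ interchanges $\alpha$ and $\beta$ on the component containing $u$ of the subgraph induced by vertices colored $\alpha$ or $\beta$; it is $L$-valid if the result is again an $L$-coloring. Two $L$-colorings are $L$-equivalent if one is obtained from the other by a sequence of $L$-valid Kempe swaps. $G$ is $L$-swappable if it has an $L$-coloring and all its $L$-colorings are pairwise $L$-equivalent. A $k$-assignment has $|L(v)|=k$ for all $v$; $G$ is $k$-swappable if it is $L$-swappable for every $k$-assignment $L$. -}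

module Defs where

open import Data.Nat using (ℕ; _≤_; _≟_)
open import Data.Bool using (Bool; true; false; if_then_else_)
open import Data.Fin using (Fin)
open import Data.Vec using (tabulate)
open import Data.Fin.Subset using (∣_∣)
open import Data.List using (List; length)
open import Data.List.Membership.Propositional using (_∈_)
open import Data.List.Relation.Unary.Unique.Propositional using (Unique)
open import Data.Product using (Σ; ∃; _×_; _,_)
open import Data.Sum using (_⊎_)
open import Relation.Nullary using (¬_)
open import Relation.Nullary.Decidable using (⌊_⌋)
open import Relation.Binary.PropositionalEquality using (_≡_; _≢_)
open import Relation.Binary.Construct.Closure.ReflexiveTransitive using (Star)

record Graph : Set where
  field
    n      : ℕ
    adj    : Fin n → Fin n → Bool
    sym    : ∀ u v → adj u v ≡ adj v u
    irrefl : ∀ v → adj v v ≡ false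

module _ (G : Graph) where
  open Graph G

  degree : Fin n → ℕ
  degree v = ∣ tabulate (adj v) ∣

  Regular : ℕ → Set
  Regular k = ∀ v → degree v ≡ k

  data PathIn (keep : Fin n → Set) : Fin n → Fin n → Set where
    here : ∀ {u} → keep u → PathIn keep u u
    step : ∀ {u v w} → PathIn keep u v → adj v w ≡ true → keep w → PathIn keep u w

  ConnectedIn : (Fin n → Set) → Set
  ConnectedIn keep = ∀ u v → keep u → keep v → PathIn keep u v

  -- G has vertex connectivity exactly 2:
  --   removing fewer than 2 vertices leaves a connected graph with at least 2 vertices
  --   (so n ≥ 3), and some set of 2 vertices separates G.
  Connectivity2 : Set
  Connectivity2 =
    (3 ≤ n)
    × ConnectedIn (λ _ → Data.Unit.⊤)
    × (∀ x → ConnectedIn (λ w → w ≢ x))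
    × Σ (Fin n) (λ x → Σ (Fin n) (λ y → x ≢ y ×
        ¬ ConnectedIn (λ w → w ≢ x × w ≢ y)))
    where import Data.Unit

  ListAssignment : Set
  ListAssignment = Fin n → List ℕ

  KAssignment : ℕ → ListAssignment → Set
  KAssignment k L = ∀ v → Unique (L v) × length (L v) ≡ k

  Coloring : Set
  Coloring = Fin n → ℕ

  IsLColoring : ListAssignment → Coloring → Set
  IsLColoring L φ = (∀ u v → adj u v ≡ true → φ u ≢ φ v) × (∀ v → φ v ∈ L v)

  InAB : Coloring → ℕ → ℕ → Fin n → Set
  InAB φ α β w = φ w ≡ α ⊎ φ w ≡ β

  swapC : ℕ → ℕ → ℕ → ℕ
  swapC α β c = if ⌊ c ≟ α ⌋ then β else (if ⌊ c ≟ β ⌋ then α else c)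

  KempeSwapAt : Coloring → Fin n → ℕ → ℕ → Coloring → Set
  KempeSwapAt φ u α β ψ =
    InAB φ α β u ×
    (∀ v → (PathIn (InAB φ α β) u v → ψ v ≡ swapC α β (φ v))
         × (¬ PathIn (InAB φ α β) u v → ψ v ≡ φ v))

  KempeSwap : Coloring → Coloring → Set
  KempeSwap φ ψ = Σ (Fin n) λ u → Σ ℕ λ α → Σ ℕ λ β → KempeSwapAt φ u α β ψ

  LSwap : ListAssignment → Coloring → Coloring → Set
  LSwap L φ ψ = KempeSwap φ ψ × IsLColoring L ψ

  LEquivalent : ListAssignment → Coloring → Coloring → Set
  LEquivalent L = Star (LSwap L)

  LSwappable : ListAssignment → Set
  LSwappable L =
    Σ Coloring (IsLColoring L) ×
    (∀ φ ψ → IsLColoring L φ → IsLColoring L ψ → LEquivalent L φ ψ)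

  KSwappable : ℕ → Set
  KSwappable k = ∀ L → KAssignment k L → LSwappable L

-- Call (v , c) loose if c is a colour of v that some neighbour of v lacks. Colouring v with c leaves a
-- neighbour with a spare colour, so by the argument of Las Vergnas and Meyniel all colourings with v
-- coloured c are equivalent. A colouring in which no vertex has a loose colour admits all Kempe swaps of
-- nontrivial chains, hence reaches every loose pair. It remains to link the loose pairs. Let A be a
-- smallest fragment, cut off by {x , y}, and B the other side. By minimality no pair containing a vertex
-- of A separates G, so if both A and B have loose vertices, loose pairs on opposite sides occur together
-- in one colouring. If the lists are constant on one side, then any Kempe change of the other side with
-- x and y joined by an edge (a graph with a spare colour at x or y) lifts to G by permuting the colours of
-- the constant side. If all lists agree, take neighbours a ∈ A and b ∈ B of x: the colourings in which a
-- and b agree are all equivalent, and the same lifting brings every colouring to one of these.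
module Submission where

open import Defs
open import Data.Nat using (ℕ; zero; suc; _≤_; _<_; z≤n; s≤s; _≟_; _<?_)
open import Data.Nat.Properties using (≤-refl; ≤-trans; ≤-reflexive; ≤-pred; <⇒≱; +-suc; ≮⇒≥)
open import Data.Bool using (Bool; true; false; if_then_else_)
import Data.Bool.Properties as Bool
open import Data.Fin using (Fin; zero; suc)
import Data.Fin.Properties as Fin
open import Data.Fin.Subset as Subset using (Subset)
open import Data.Fin.Subset.Properties using (anySubset?)
import Data.Vec as Vec
open import Data.Vec.Properties using (lookup∘tabulate)
open import Data.List as List using (List; []; _∷_; length; filter; allFin; map; _++_)
open import Data.List.Properties using (length-map; length-++)
open import Data.List.Membership.Propositional using (_∈_; _∉_)
open import Data.List.Membership.Propositional.Properties using (∈-filter⁺; ∈-filter⁻; ∈-allFin; ∈-∃++; ∈-++⁺ˡ; ∈-++⁺ʳ; ∈-++⁻; ∈-map⁺)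
open import Data.List.Membership.DecPropositional _≟_ using (_∈?_)
open import Data.List.Relation.Unary.Any using (here; there)
import Data.List.Relation.Unary.All as All
open import Data.List.Relation.Unary.AllPairs using ([]; _∷_)
open import Data.List.Relation.Unary.Unique.Propositional using (Unique)
open import Data.List.Relation.Unary.Unique.Propositional.Properties using (filter⁺; allFin⁺)
open import Data.Product using (∃; ∃₂; _×_; _,_; proj₁; proj₂; Σ-syntax)
open import Data.Sum using (_⊎_; inj₁; inj₂; [_,_]′; swap)
open import Data.Empty using (⊥; ⊥-elim)
open import Data.Unit using (⊤; tt)
open import Function using (_∘_; id; case_of_)
open import Relation.Nullary using (¬_; Dec; yes; no; contradiction; does)
open import Relation.Nullary.Decidable using (_×-dec_; _⊎-dec_; _→-dec_; ¬?; ⌊_⌋; dec-true)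
open import Relation.Binary.PropositionalEquality using (_≡_; _≢_; refl; sym; trans; cong; subst; ≢-sym)
open import Relation.Binary.Construct.Closure.ReflexiveTransitive using (Star; ε; _◅_; _◅◅_)

-- Joining x and y is what lets one side be recoloured without regard to the other: if both have
-- colours α or β they lie in one α,β-chain, so the far side is exchanged either entirely or not at
-- all. The edge costs one degree at x and y, so a spare colour needs two lost neighbours.
-- Minimality of A provides two inside A, but outside A the vertex x may have a single neighbour b;
-- the cut is then moved to {b , y}. This case is not empty: if A with x and y is a complete graph
-- on k + 1 vertices without the edge between x and y, and its lists agree, then every colouring
-- gives x and y the same colour, so equality of these colours must serve as the invariant. The
-- other obstacle is a loose colour at x or y, which belong to neither side: it may coincide with
-- the only loose colour of their neighbours in A. When all lists agree there is no loose pair at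
-- all; giving a and b one colour then takes two neighbours but only one colour from x, and this
-- replaces the missing spare colour.

pigeonhole : ∀ {A : Set} {xs ys : List A} → Unique xs → (∀ {z} → z ∈ xs → z ∈ ys) → length xs ≤ length ys
pigeonhole {xs = []} _ _ = z≤n
pigeonhole {xs = x ∷ xs} (x∉ ∷ u) sub with ∈-∃++ (sub (here refl))
... | as , bs , refl = ≤-trans (s≤s (pigeonhole u sub′)) (≤-reflexive len)
  where
  sub′ : ∀ {z} → z ∈ xs → z ∈ as ++ bs
  sub′ z∈ with ∈-++⁻ as (sub (there z∈))
  ... | inj₁ p = ∈-++⁺ˡ p
  ... | inj₂ (here refl) = ⊥-elim (All.lookup x∉ z∈ refl)
  ... | inj₂ (there p) = ∈-++⁺ʳ as p
  len : suc (length (as ++ bs)) ≡ length (as ++ x ∷ bs)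
  len rewrite length-++ as {bs} | length-++ as {x ∷ bs} = sym (+-suc (length as) (length bs))

subset-or-not : (xs ys : List ℕ) → (∀ {c} → c ∈ xs → c ∈ ys) ⊎ (∃ λ c → c ∈ xs × c ∉ ys)
subset-or-not [] ys = inj₁ λ ()
subset-or-not (x ∷ xs) ys with x ∈? ys | subset-or-not xs ys
... | no x∉ | _ = inj₂ (x , here refl , x∉)
... | yes _ | inj₂ (c , c∈ , c∉) = inj₂ (c , there c∈ , c∉)
... | yes x∈ | inj₁ sub = inj₁ λ { (here refl) → x∈ ; (there p) → sub p }

free-element : ∀ {xs} zs → Unique xs → length zs < length xs → ∃ λ c → c ∈ xs × c ∉ zs
free-element {xs} zs u lt with subset-or-not xs zs
... | inj₁ sub = contradiction (pigeonhole u sub) (<⇒≱ lt)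
... | inj₂ r = r

unique-∷ : ∀ {A : Set} {x : A} {xs} → x ∉ xs → Unique xs → Unique (x ∷ xs)
unique-∷ x∉ u = All.tabulate (λ { z∈ refl → x∉ z∈ }) ∷ u

⊆-of-equal-length : ∀ {xs ys} → Unique xs → length ys ≤ length xs →
  (∀ {c} → c ∈ xs → c ∈ ys) → ∀ {c} → c ∈ ys → c ∈ xs
⊆-of-equal-length {xs} {ys} u le sub {c} c∈ with c ∈? xs
... | yes p = p
... | no c∉ = contradiction (pigeonhole (unique-∷ c∉ u) λ { (here refl) → c∈ ; (there p) → sub p })
                            (<⇒≱ (s≤s le))

-- Exchanging two colours

AB : ℕ → ℕ → ℕ → Set
AB α β c = c ≡ α ⊎ c ≡ β

ab? : ∀ α β c → Dec (AB α β c)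
ab? α β c = (c ≟ α) ⊎-dec (c ≟ β)

opaque
  -- The same formula as `swapC`, kept opaque so that goals show the exchange and not its tests;
  -- `sw-unfold` leads back to `swapC` at the end.
  sw : ℕ → ℕ → ℕ → ℕ
  sw α β c = if ⌊ c ≟ α ⌋ then β else (if ⌊ c ≟ β ⌋ then α else c)

  sw-unfold : ∀ α β c → sw α β c ≡ (if ⌊ c ≟ α ⌋ then β else (if ⌊ c ≟ β ⌋ then α else c))
  sw-unfold α β c = refl

  sw-α : ∀ α β → sw α β α ≡ β
  sw-α α β with α ≟ α
  ... | yes _ = refl
  ... | no ne = ⊥-elim (ne refl)

  sw-β : ∀ α β → sw α β β ≡ α
  sw-β α β with β ≟ α | β ≟ β
  ... | yes e | _ = e
  ... | no _ | yes _ = refl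
  ... | no _ | no ne = ⊥-elim (ne refl)

  sw-other : ∀ {α β c} → ¬ AB α β c → sw α β c ≡ c
  sw-other {α} {β} {c} n with c ≟ α | c ≟ β
  ... | yes e | _ = ⊥-elim (n (inj₁ e))
  ... | no _ | yes e = ⊥-elim (n (inj₂ e))
  ... | no _ | no _ = refl

sw-AB : ∀ {α β c} → AB α β c → AB α β (sw α β c)
sw-AB {α} {β} (inj₁ refl) = inj₂ (sw-α α β)
sw-AB {α} {β} (inj₂ refl) = inj₁ (sw-β α β)

sw-involutive : ∀ α β c → sw α β (sw α β c) ≡ c
sw-involutive α β c with ab? α β c
... | yes (inj₁ refl) rewrite sw-α α β = sw-β α β
... | yes (inj₂ refl) rewrite sw-β α β = sw-α α β
... | no n rewrite sw-other n = sw-other n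

sw-injective : ∀ α β {c d} → sw α β c ≡ sw α β d → c ≡ d
sw-injective α β {c} {d} e =
  trans (sym (sw-involutive α β c)) (trans (cong (sw α β) e) (sw-involutive α β d))

AB-sw : ∀ {α β c} → AB α β (sw α β c) → AB α β c
AB-sw {α} {β} {c} p = subst (AB α β) (sw-involutive α β c) (sw-AB p)

-- Serves for edges: neighbours in a chain have different colours, so each has the exchange of the
-- other's.
AB-other : ∀ {α β c d} → AB α β c → AB α β d → c ≢ d → d ≡ sw α β c
AB-other (inj₁ refl) (inj₁ refl) ne = ⊥-elim (ne refl)
AB-other {α} {β} (inj₁ refl) (inj₂ refl) _ = sym (sw-α α β)
AB-other {α} {β} (inj₂ refl) (inj₁ refl) _ = sym (sw-β α β)
AB-other (inj₂ refl) (inj₂ refl) ne = ⊥-elim (ne refl)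

-- Vertex sets, edge relations, partial colourings and Kempe moves

record VSet (n : ℕ) : Set₁ where
  field
    Mem  : Fin n → Set
    mem? : ∀ v → Dec (Mem v)
open VSet

infix 4 _∋_
_∋_ : ∀ {n} → VSet n → Fin n → Set
P ∋ v = Mem P v

-- Separate from `Graph` because edges absent from G are added later.
record Net (n : ℕ) : Set₁ where
  field
    Edge  : Fin n → Fin n → Set
    edge? : ∀ u w → Dec (Edge u w)
    esym  : ∀ {u w} → Edge u w → Edge w u
    eirr  : ∀ {v} → ¬ Edge v v
open Net

module _ {n : ℕ} where

  infixl 6 _-_ _∪₁_
  _-_ : VSet n → Fin n → VSet n
  P - v = record { Mem = λ u → P ∋ u × u ≢ v ; mem? = λ u → mem? P u ×-dec ¬? (u Fin.≟ v) }

  _∪₁_ : VSet n → Fin n → VSet n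
  P ∪₁ v = record { Mem = λ u → P ∋ u ⊎ u ≡ v ; mem? = λ u → mem? P u ⊎-dec (u Fin.≟ v) }

  Whole : VSet n
  Whole = record { Mem = λ _ → ⊤ ; mem? = λ _ → yes tt }

  ∁ : VSet n → VSet n
  ∁ P = record { Mem = λ u → ¬ P ∋ u ; mem? = λ u → ¬? (mem? P u) }

  ⟨_⟩ : Fin n → VSet n
  ⟨ v ⟩ = record { Mem = _≡ v ; mem? = Fin._≟ v }

  members : VSet n → List (Fin n)
  members P = filter (mem? P) (allFin n)

  size : VSet n → ℕ
  size P = length (members P)

  ∈-members : ∀ P {u} → P ∋ u → u ∈ members P
  ∈-members P p = ∈-filter⁺ (mem? P) (∈-allFin _) p

  members-∈ : ∀ P {u} → u ∈ members P → P ∋ u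
  members-∈ P p = proj₂ (∈-filter⁻ (mem? P) {xs = allFin n} p)

  members-unique : ∀ P → Unique (members P)
  members-unique P = filter⁺ (mem? P) (allFin⁺ n)

  size-mono : ∀ P Q → (∀ {u} → P ∋ u → Q ∋ u) → size P ≤ size Q
  size-mono P Q sub = pigeonhole (members-unique P) (λ p → ∈-members Q (sub (members-∈ P p)))

  size-< : ∀ P Q {z} → (∀ {u} → P ∋ u → Q ∋ u) → Q ∋ z → ¬ P ∋ z → size P < size Q
  size-< P Q {z} sub qz npz =
    pigeonhole (unique-∷ (npz ∘ members-∈ P) (members-unique P))
      λ { (here refl) → ∈-members Q qz ; (there p) → ∈-members Q (sub (members-∈ P p)) }

  Nb : Net n → VSet n → Fin n → VSet n
  Nb E P w = record { Mem = λ u → Edge E w u × P ∋ u ; mem? = λ u → edge? E w u ×-dec mem? P u }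

  deg : Net n → VSet n → Fin n → ℕ
  deg E P w = size (Nb E P w)

  Colouring : Set
  Colouring = Fin n → ℕ

  Palette : Set
  Palette = Fin n → List ℕ

  _≗[_]_ : Colouring → VSet n → Colouring → Set
  φ ≗[ P ] ψ = ∀ {u} → P ∋ u → φ u ≡ ψ u

  infixl 7 _[_↦_]
  _[_↦_] : Colouring → Fin n → ℕ → Colouring
  (φ [ r ↦ c ]) v = if ⌊ v Fin.≟ r ⌋ then c else φ v

  upd-same : ∀ φ r c → (φ [ r ↦ c ]) r ≡ c
  upd-same φ r c with r Fin.≟ r
  ... | yes _ = refl
  ... | no ne = ⊥-elim (ne refl)

  upd-other : ∀ φ {r c v} → v ≢ r → (φ [ r ↦ c ]) v ≡ φ v
  upd-other φ {r} {c} {v} ne with v Fin.≟ r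
  ... | yes e = ⊥-elim (ne e)
  ... | no _ = refl

  -- Colourings stay total functions with arbitrary values off P; hence the comparisons by `≗[ P ]`.
  record Valid (E : Net n) (L : Palette) (P : VSet n) (φ : Colouring) : Set where
    constructor valid
    field
      proper : ∀ {u w} → P ∋ u → P ∋ w → Edge E u w → φ u ≢ φ w
      listed : ∀ {u} → P ∋ u → φ u ∈ L u
  open Valid public

  valid-cong : ∀ {E L P φ ψ} → Valid E L P φ → ψ ≗[ P ] φ → Valid E L P ψ
  valid-cong {L = L} v eq .proper pu pw e q = proper v pu pw e (trans (sym (eq pu)) (trans q (eq pw)))
  valid-cong {L = L} v eq .listed {u} pu = subst (_∈ L u) (sym (eq pu)) (listed v pu)

  valid-⊆ : ∀ {E L P Q φ} → (∀ {u} → Q ∋ u → P ∋ u) → Valid E L P φ → Valid E L Q φ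
  valid-⊆ sub v .proper pu pw = proper v (sub pu) (sub pw)
  valid-⊆ sub v .listed pu = listed v (sub pu)

  swapOn : ℕ → ℕ → VSet n → Colouring → Colouring
  swapOn α β W φ v = if ⌊ mem? W v ⌋ then sw α β (φ v) else φ v

  swapOn-in : ∀ α β W φ {v} → W ∋ v → swapOn α β W φ v ≡ sw α β (φ v)
  swapOn-in α β W φ {v} w with mem? W v
  ... | yes _ = refl
  ... | no nw = ⊥-elim (nw w)

  swapOn-out : ∀ α β W φ {v} → ¬ W ∋ v → swapOn α β W φ v ≡ φ v
  swapOn-out α β W φ {v} nw with mem? W v
  ... | yes w = ⊥-elim (nw w)
  ... | no _ = refl

  -- A union of α,β-Kempe chains; swapping all of them at once keeps paths out of the argument.
  record KempeSet (E : Net n) (P : VSet n) (φ : Colouring) (α β : ℕ) (W : VSet n) : Set where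
    field
      inside : ∀ {v} → W ∋ v → P ∋ v
      bicol  : ∀ {v} → W ∋ v → AB α β (φ v)
      closed : ∀ {u w} → W ∋ u → Edge E u w → P ∋ w → AB α β (φ w) → W ∋ w
  open KempeSet public

  -- `on` and `off` describe ψ pointwise, so it need only agree with the swapped function. `off`
  -- also covers vertices off P, so a vertex that was removed from P keeps its colour. Validity on
  -- both ends makes moves reversible.
  record Move (E : Net n) (L : Palette) (P : VSet n) (φ ψ : Colouring) : Set₁ where
    field
      α β    : ℕ
      W      : VSet n
      kempe  : KempeSet E P φ α β W
      on     : ∀ {v} → W ∋ v → ψ v ≡ sw α β (φ v)
      off    : ∀ {v} → ¬ W ∋ v → ψ v ≡ φ v
      before : Valid E L P φ
      after  : Valid E L P ψ

  Steps : Net n → Palette → VSet n → Colouring → Colouring → Set₁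
  Steps E L P = Star (Move E L P)

  kempeSet-cong : ∀ {E P φ ψ α β W} → ψ ≗[ P ] φ → KempeSet E P φ α β W → KempeSet E P ψ α β W
  kempeSet-cong eq k .inside = inside k
  kempeSet-cong {α = α} {β} eq k .bicol w = subst (AB α β) (sym (eq (inside k w))) (bicol k w)
  kempeSet-cong {α = α} {β} eq k .closed w e p ab = closed k w e p (subst (AB α β) (eq p) ab)

  swap-valid : ∀ {E L P φ ψ α β W} → Valid E L P φ → KempeSet E P φ α β W →
    (∀ {v} → W ∋ v → ψ v ≡ sw α β (φ v)) → (∀ {v} → ¬ W ∋ v → ψ v ≡ φ v) →
    (∀ {v} → W ∋ v → sw α β (φ v) ∈ L v) → Valid E L P ψ
  swap-valid {E} {L} {P} {φ} {ψ} {α} {β} {W} vφ k on off inL = valid pr li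
    where
    differ : ∀ {u w} → P ∋ u → P ∋ w → Edge E u w → W ∋ u → ¬ W ∋ w → ψ u ≢ ψ w
    differ pu pw e wu nww q =
      nww (closed k wu e pw (subst (AB α β) (trans (sym (on wu)) (trans q (off nww))) (sw-AB (bicol k wu))))
    pr : ∀ {u w} → P ∋ u → P ∋ w → Edge E u w → ψ u ≢ ψ w
    pr {u} {w} pu pw e q with mem? W u | mem? W w
    ... | yes a | yes b = proper vφ pu pw e (sw-injective α β (trans (sym (on a)) (trans q (on b))))
    ... | yes a | no b = differ pu pw e a b q
    ... | no a | yes b = differ pw pu (esym E e) b a (sym q)
    ... | no a | no b = proper vφ pu pw e (trans (sym (off a)) (trans q (off b)))
    li : ∀ {u} → P ∋ u → ψ u ∈ L u
    li {u} pu with mem? W u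
    ... | yes a = subst (_∈ L u) (sym (on a)) (inL a)
    ... | no a = subst (_∈ L u) (sym (off a)) (listed vφ pu)

  swapOn-move : ∀ {E L P φ α β W} → Valid E L P φ → KempeSet E P φ α β W →
    (∀ {v} → W ∋ v → sw α β (φ v) ∈ L v) → Move E L P φ (swapOn α β W φ)
  swapOn-move {φ = φ} {α} {β} {W} v k inL = record
    { α = α ; β = β ; W = W ; kempe = k
    ; on = swapOn-in α β W φ ; off = swapOn-out α β W φ ; before = v
    ; after = swap-valid v k (swapOn-in α β W φ) (swapOn-out α β W φ) inL }

  -- The vertex r alone is a full chain for its old colour and c: properness excludes the old colour
  -- on its neighbours, the last hypothesis excludes c.
  recolor : ∀ {E L P φ r c} → Valid E L P φ → P ∋ r → c ∈ L r →
    (∀ {u} → P ∋ u → Edge E r u → φ u ≢ c) → Move E L P φ (φ [ r ↦ c ])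
  recolor {E} {L} {P} {φ} {r} {c} v pr cL free = record
    { α = φ r ; β = c ; W = ⟨ r ⟩ ; kempe = k ; on = on ; off = upd-other φ ; before = v
    ; after = swap-valid v k on (upd-other φ) (λ { refl → subst (_∈ L r) (sym (sw-α (φ r) c)) cL }) }
    where
    on : ∀ {u} → u ≡ r → (φ [ r ↦ c ]) u ≡ sw (φ r) c (φ u)
    on refl = trans (upd-same φ r c) (sym (sw-α (φ r) c))
    k : KempeSet E P φ (φ r) c ⟨ r ⟩
    k .inside refl = pr
    k .bicol refl = inj₁ refl
    k .closed refl e p (inj₁ q) = ⊥-elim (proper v pr p e (sym q))
    k .closed refl e p (inj₂ q) = ⊥-elim (free p e q)

  move-inverse : ∀ {E L P φ ψ} → Move E L P φ ψ → Move E L P ψ φ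
  move-inverse {E} {L} {P} {φ} {ψ} m = record
    { α = α ; β = β ; W = W ; kempe = k
    ; on = λ {v} w → trans (sym (sw-involutive α β (φ v))) (cong (sw α β) (sym (on w)))
    ; off = λ w → sym (off w) ; before = after ; after = before }
    where
    open Move m
    back : ∀ {v} → AB α β (ψ v) → AB α β (φ v)
    back {v} ab with mem? W v
    ... | yes w = AB-sw (subst (AB α β) (on w) ab)
    ... | no w = subst (AB α β) (off w) ab
    k : KempeSet E P ψ α β W
    k .inside = inside kempe
    k .bicol w = subst (AB α β) (sym (on w)) (sw-AB (bicol kempe w))
    k .closed w e p ab = closed kempe w e p (back ab)

  steps-inverse : ∀ {E L P φ ψ} → Steps E L P φ ψ → Steps E L P ψ φ
  steps-inverse ε = ε
  steps-inverse (m ◅ s) = steps-inverse s ◅◅ (move-inverse m ◅ ε)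

  steps-valid : ∀ {E L P φ ψ} → Valid E L P φ → Steps E L P φ ψ → Valid E L P ψ
  steps-valid v ε = v
  steps-valid v (m ◅ s) = steps-valid (Move.after m) s

  identity-move : ∀ {E L P φ ψ} → Valid E L P φ → (∀ v → ψ v ≡ φ v) → Move E L P φ ψ
  identity-move v eq = record
    { α = 0 ; β = 0 ; W = record { Mem = λ _ → ⊥ ; mem? = λ _ → no λ () }
    ; kempe = record { inside = λ () ; bicol = λ () ; closed = λ () }
    ; on = λ () ; off = λ _ → eq _ ; before = v ; after = valid-cong v (λ _ → eq _) }

  -- Sets in which every component has a slack vertex: colouring and Kempe equivalence

  record Good (E : Net n) (L : Palette) (P : VSet n) : Set₁ where
    field
      uniq  : ∀ v → Unique (L v)
      tight : ∀ {v} → P ∋ v → deg E P v ≤ length (L v)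
      -- Every component of P contains a slack vertex. Closed sets express this without a root,
      -- because deleting a vertex may disconnect P.
      reach : ∀ T → (∀ {r} → P ∋ r → deg E P r < length (L r) → T ∋ r) →
              (∀ {u w} → T ∋ u → P ∋ u → Edge E u w → P ∋ w → T ∋ w) → ∀ {w} → P ∋ w → T ∋ w
  open Good public

  deg-mono : ∀ E P Q {v} → (∀ {u} → P ∋ u → Q ∋ u) → deg E P v ≤ deg E Q v
  deg-mono E P Q {v} sub = size-mono (Nb E P v) (Nb E Q v) λ (e , p) → e , sub p

  deg-< : ∀ E P Q {v z} → (∀ {u} → P ∋ u → Q ∋ u) → Edge E v z → Q ∋ z → ¬ P ∋ z → deg E P v < deg E Q v
  deg-< E P Q {v} sub e q np = size-< (Nb E P v) (Nb E Q v) (λ (e , p) → e , sub p) (e , q) (np ∘ proj₂)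

  -- Each neighbour of r loses a neighbour and no colour, hence becomes slack. A component of
  -- `P - r` contains such a neighbour or is an old component with its old slack vertex.
  good-remove : ∀ {E L P r} → Good E L P → P ∋ r → deg E P r < length (L r) → Good E L (P - r)
  good-remove {E} {L} {P} {r} g pr slack = record
    { uniq = uniq g
    ; tight = λ (p , _) → ≤-trans (deg-mono E (P - r) P proj₁) (tight g p)
    ; reach = λ T sl cl {w} (p , ne) → case reach g (T ∪₁ r) (sl′ T sl) (cl′ T sl cl) p of
        λ { (inj₁ t) → t ; (inj₂ e) → ⊥-elim (ne e) } }
    where
    module _ (T : VSet n) (sl : ∀ {s} → (P - r) ∋ s → deg E (P - r) s < length (L s) → T ∋ s) where
      sl′ : ∀ {s} → P ∋ s → deg E P s < length (L s) → (T ∪₁ r) ∋ s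
      sl′ {s} p d with s Fin.≟ r
      ... | yes e = inj₂ e
      ... | no ne = inj₁ (sl (p , ne) (≤-trans (s≤s (deg-mono E (P - r) P proj₁)) d))
      cl′ : (∀ {u w} → T ∋ u → (P - r) ∋ u → Edge E u w → (P - r) ∋ w → T ∋ w) →
            ∀ {u w} → (T ∪₁ r) ∋ u → P ∋ u → Edge E u w → P ∋ w → (T ∪₁ r) ∋ w
      cl′ cl {u} {w} t pu e pw with w Fin.≟ r | u Fin.≟ r
      ... | yes q | _ = inj₂ q
      ... | no ne | yes refl = inj₁ (sl (pw , ne)
              (≤-trans (deg-< E (P - r) P proj₁ (esym E e) pr (λ q → proj₂ q refl)) (tight g pw)))
      ... | no ne | no nu = inj₁ (cl ([ id , (λ q → ⊥-elim (nu q)) ]′ t) (pu , nu) e (pw , ne))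

  -- If no vertex is slack, the empty set meets the hypotheses of `reach`, which leaves P empty.
  good-slack : ∀ {E L P} → Good E L P → (∀ {v} → ¬ P ∋ v) ⊎ (∃ λ r → P ∋ r × deg E P r < length (L r))
  good-slack {E} {L} {P} g with Fin.any? (λ r → mem? P r ×-dec (deg E P r <? length (L r)))
  ... | yes s = inj₂ s
  ... | no none = inj₁ (reach g (record { Mem = λ _ → ⊥ ; mem? = λ _ → no λ () })
                          (λ p d → none (_ , p , d)) (λ ()))

  extend : ∀ {E L P φ r c} → Valid E L (P - r) φ → c ∈ L r →
    (∀ {u} → P ∋ u → Edge E r u → φ u ≢ c) → Valid E L P (φ [ r ↦ c ])
  extend {E} {L} {P} {φ} {r} {c} v cL free = valid pr li
    where
    pr : ∀ {u w} → P ∋ u → P ∋ w → Edge E u w → (φ [ r ↦ c ]) u ≢ (φ [ r ↦ c ]) w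
    pr {u} {w} pu pw e q with u Fin.≟ r | w Fin.≟ r
    ... | yes refl | yes refl = eirr E e
    ... | yes refl | no _ = free pw e (sym q)
    ... | no _ | yes refl = free pu (esym E e) q
    ... | no a | no b = proper v (pu , a) (pw , b) e q
    li : ∀ {u} → P ∋ u → (φ [ r ↦ c ]) u ∈ L u
    li {u} pu with u Fin.≟ r
    ... | yes refl = cL
    ... | no a = listed v (pu , a)

  avoid-neighbours : ∀ {E} {L : Palette} {P : VSet n} {r} (φ : Colouring) → Unique (L r) → deg E P r < length (L r) →
    ∃ λ c → c ∈ L r × (∀ {u} → P ∋ u → Edge E r u → φ u ≢ c)
  avoid-neighbours {E} {L} {P} {r} φ u d
    with free-element (map φ (members (Nb E P r))) u (subst (_< length (L r)) (sym (length-map φ (members (Nb E P r)))) d)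
  ... | c , cL , c∉ = c , cL , λ { p e refl → c∉ (∈-map⁺ φ (∈-members (Nb E P r) (e , p))) }

  good-colorable : ∀ {E L P} → Good E L P → ∃ (Valid E L P)
  good-colorable {P = P} g = go (size P) g ≤-refl
    where
    go : ∀ m {E L P} → Good E L P → size P ≤ m → ∃ (Valid E L P)
    go m {E} {L} {P} g le with good-slack g
    ... | inj₁ empty = (λ _ → 0) , valid (λ p → ⊥-elim (empty p)) (λ p → ⊥-elim (empty p))
    go zero {P = P} g le | inj₂ (r , pr , d) = contradiction (size-< (P - r) P proj₁ pr (λ q → proj₂ q refl)) (<⇒≱ (s≤s (≤-trans le z≤n)))
    go (suc m) {E} {L} {P} g le | inj₂ (r , pr , d)
      with go m (good-remove g pr d) (≤-pred (≤-trans (size-< (P - r) P proj₁ pr (λ q → proj₂ q refl)) le))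
    ... | φ , v with avoid-neighbours {E} {L} {P} φ (uniq g r) d
    ... | c , cL , free = φ [ r ↦ c ] , extend v cL free

  module _ {E : Net n} {L : Palette} {P : VSet n} {r : Fin n} (pr : P ∋ r)
           (ur : Unique (L r)) (slack : deg E P r < length (L r)) where

    -- Las Vergnas and Meyniel: a slack vertex r that blocks a swap in P - r either joins it or is
    -- first given a colour outside {α , β}.
    lift-slack : ∀ {φ φ₀ χ₀} → Move E L (P - r) φ₀ χ₀ → Valid E L P φ → φ ≗[ P - r ] φ₀ →
      ∃ λ χ → Steps E L P φ χ × χ ≗[ P - r ] χ₀
    lift-slack {φ} {φ₀} {χ₀} m v eq = cases
      where
      open Move m
      inW : ∀ {u} → W ∋ u → (P - r) ∋ u
      inW = inside kempe
      listW : ∀ {u} → W ∋ u → sw α β (φ₀ u) ∈ L u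
      listW {u} w = subst (_∈ L u) (on w) (listed after (inW w))
      module Go (φ : Colouring) (v : Valid E L P φ) (eq : φ ≗[ P - r ] φ₀) where
        agree : ∀ W′ → (∀ {u} → (P - r) ∋ u → W′ ∋ u → W ∋ u) → (∀ {u} → W ∋ u → W′ ∋ u) →
          swapOn α β W′ φ ≗[ P - r ] χ₀
        agree W′ to from {u} p with mem? W′ u
        ... | yes w = trans (cong (sw α β) (eq p)) (sym (on (to p w)))
        ... | no w = trans (eq p) (sym (off (w ∘ from)))
        base : ∀ {u w} → W ∋ u → Edge E u w → P ∋ w → w ≢ r → AB α β (φ w) → W ∋ w
        base w e p ne ab = closed kempe w e (p , ne) (subst (AB α β) (eq (p , ne)) ab)
        plain : (∀ {u} → W ∋ u → Edge E u r → ¬ AB α β (φ r)) →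
          ∃ λ χ → Steps E L P φ χ × χ ≗[ P - r ] χ₀
        plain no-r = swapOn α β W φ , swapOn-move v k (λ {u} w → subst (λ z → sw α β z ∈ L u) (sym (eq (inW w))) (listW w)) ◅ ε
                   , agree W (λ _ w → w) id
          where
          k : KempeSet E P φ α β W
          k .inside w = proj₁ (inW w)
          k .bicol w = subst (AB α β) (sym (eq (inW w))) (bicol kempe w)
          k .closed {u} {w} wu e p ab with w Fin.≟ r
          ... | yes refl = ⊥-elim (no-r wu e ab)
          ... | no ne = base wu e p ne ab
        -- The last hypothesis says that r is tied to no chain outside W, so W together with r is
        -- closed.
        joined : AB α β (φ r) → sw α β (φ r) ∈ L r →
          (∀ {w} → Edge E r w → P ∋ w → φ w ≡ sw α β (φ r) → W ∋ w) →
          ∃ λ χ → Steps E L P φ χ × χ ≗[ P - r ] χ₀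
        joined ab cL all = swapOn α β (W ∪₁ r) φ , swapOn-move v k lst ◅ ε
                         , agree (W ∪₁ r) (λ { _ (inj₁ w) → w ; (_ , ne) (inj₂ e) → ⊥-elim (ne e) }) inj₁
          where
          lst : ∀ {u} → (W ∪₁ r) ∋ u → sw α β (φ u) ∈ L u
          lst {u} (inj₁ w) = subst (λ z → sw α β z ∈ L u) (sym (eq (inW w))) (listW w)
          lst (inj₂ refl) = cL
          k : KempeSet E P φ α β (W ∪₁ r)
          k .inside (inj₁ w) = proj₁ (inW w)
          k .inside (inj₂ refl) = pr
          k .bicol (inj₁ w) = subst (AB α β) (sym (eq (inW w))) (bicol kempe w)
          k .bicol (inj₂ refl) = ab
          k .closed {u} {w} wu e p abw with w Fin.≟ r
          ... | yes q = inj₂ q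
          k .closed (inj₁ wu) e p abw | no ne = inj₁ (base wu e p ne abw)
          k .closed (inj₂ refl) e p abw | no ne = inj₁ (all e p (AB-other ab abw (proper v pr p e)))
      open Go φ v eq
      -- Deleting one of the neighbours coloured δ loses no constraint on the new colour of r.
      escape : ∀ {w} → W ∋ w → Edge E r w → AB α β (φ r) →
        (sw α β (φ r) ∉ L r ⊎ ∃ λ z → Edge E r z × P ∋ z × z ≢ w × φ z ≡ sw α β (φ r)) →
        ∃ λ χ → Steps E L P φ χ × χ ≗[ P - r ] χ₀
      escape {w} ww e ab blocked
        -- One entry for r and one for each neighbour but w: at most `deg E P r` excluded colours.
        -- The colour of w itself is still avoided, thanks to `blocked`.
        with free-element (φ r ∷ map φ (members (Nb E (P - w) r))) ur
               (≤-trans (s≤s (subst (λ l → suc l ≤ deg E P r) (sym (length-map φ (members (Nb E (P - w) r))))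
                  (deg-< E (P - w) P proj₁ e (proj₁ (inW ww)) (λ q → proj₂ q refl)))) slack)
      ... | c , cL , c∉ = finish (Go.plain φ₁ (Move.after mv) eq₁ λ _ _ → notAB)
        where
        c≢r : c ≢ φ r
        c≢r q = c∉ (here q)
        others : ∀ {u} → P ∋ u → Edge E r u → u ≢ w → φ u ≢ c
        others p e′ ne refl = c∉ (there (∈-map⁺ φ (∈-members (Nb E (P - w) r) (e′ , p , ne))))
        c≢δ : c ≢ sw α β (φ r)
        c≢δ q = case blocked of λ
          { (inj₁ δ∉) → δ∉ (subst (_∈ L r) q cL)
          ; (inj₂ (z , ez , pz , ne , qz)) → others pz ez ne (trans qz (sym q)) }
        φw : φ w ≡ sw α β (φ r)
        φw = AB-other ab (subst (AB α β) (sym (eq (inW ww))) (bicol kempe ww)) (proper v pr (proj₁ (inW ww)) e)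
        free : ∀ {u} → P ∋ u → Edge E r u → φ u ≢ c
        free {u} p e′ q with u Fin.≟ w
        ... | yes refl = c≢δ (trans (sym q) φw)
        ... | no ne = others p e′ ne q
        mv : Move E L P φ (φ [ r ↦ c ])
        mv = recolor v pr cL free
        φ₁ : Colouring
        φ₁ = φ [ r ↦ c ]
        eq₁ : φ₁ ≗[ P - r ] φ₀
        eq₁ q = trans (upd-other φ (proj₂ q)) (eq q)
        notAB : ¬ AB α β (φ₁ r)
        notAB q = c≢δ (AB-other ab (subst (AB α β) (upd-same φ r c) q) (≢-sym c≢r))
        finish : (∃ λ χ → Steps E L P φ₁ χ × χ ≗[ P - r ] χ₀) → ∃ λ χ → Steps E L P φ χ × χ ≗[ P - r ] χ₀
        finish (χ , s , a) = χ , mv ◅ s , a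
      cases : ∃ λ χ → Steps E L P φ χ × χ ≗[ P - r ] χ₀
      cases with ab? α β (φ r) | Fin.any? (λ w → edge? E r w ×-dec mem? W w)
      ... | no nab | _ = plain λ _ _ → nab
      ... | yes _ | no none = plain λ w e _ → none (_ , esym E e , w)
      ... | yes ab | yes (w , e , ww)
        with sw α β (φ r) ∈? L r
           | Fin.any? (λ z → edge? E r z ×-dec (mem? P z ×-dec ((φ z ≟ sw α β (φ r)) ×-dec ¬? (mem? W z))))
      ... | no δ∉ | _ = escape ww e ab (inj₁ δ∉)
      ... | yes _ | yes (z , ez , pz , qz , nz) = escape ww e ab (inj₂ (z , ez , pz , (λ { refl → nz ww }) , qz))
      ... | yes δ∈ | no none = joined ab δ∈ all
        where
        all : ∀ {z} → Edge E r z → P ∋ z → φ z ≡ sw α β (φ r) → W ∋ z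
        all {z} ez pz qz with mem? W z
        ... | yes w = w
        ... | no nw = ⊥-elim (none (z , ez , pz , qz , nw))

    lift-slack* : ∀ {φ φ₀ χ₀} → Steps E L (P - r) φ₀ χ₀ → Valid E L P φ → φ ≗[ P - r ] φ₀ →
      ∃ λ χ → Steps E L P φ χ × χ ≗[ P - r ] χ₀
    lift-slack* {φ} ε v eq = φ , ε , eq
    lift-slack* (m ◅ s) v eq with lift-slack m v eq
    ... | χ , t , eq₁ with lift-slack* s (steps-valid v t) eq₁
    ... | χ′ , t′ , eq₂ = χ′ , t ◅◅ t′ , eq₂

  good-swappable : ∀ {E L P φ ψ} → Good E L P → Valid E L P φ → Valid E L P ψ →
    ∃ λ χ → Steps E L P φ χ × χ ≗[ P ] ψ
  good-swappable {P = P} g = go (size P) g ≤-refl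
    where
    go : ∀ m {E L P φ ψ} → Good E L P → size P ≤ m → Valid E L P φ → Valid E L P ψ →
      ∃ λ χ → Steps E L P φ χ × χ ≗[ P ] ψ
    go m {φ = φ} g le vφ vψ with good-slack g
    ... | inj₁ empty = φ , ε , λ p → ⊥-elim (empty p)
    go zero {P = P} g le vφ vψ | inj₂ (r , pr , d) = contradiction (size-< (P - r) P proj₁ pr (λ q → proj₂ q refl)) (<⇒≱ (s≤s (≤-trans le z≤n)))
    go (suc m) {E} {L} {P} {φ} {ψ} g le vφ vψ | inj₂ (r , pr , d)
      with go m (good-remove g pr d) (≤-pred (≤-trans (size-< (P - r) P proj₁ pr (λ q → proj₂ q refl)) le))
              (valid-⊆ proj₁ vφ) (valid-⊆ proj₁ vψ)
    ... | χ₀ , s₀ , eq₀ with lift-slack* pr (uniq g r) d s₀ vφ (λ _ → refl)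
    -- All neighbours of r in P now have their colours under ψ, so r can take `ψ r` by one
    -- recolouring.
    ... | χ , s , eq = χ [ r ↦ ψ r ] , s ◅◅ (recolor (steps-valid vφ s) pr (listed vψ pr) free ◅ ε) , agree
      where
      free : ∀ {u} → P ∋ u → Edge E r u → χ u ≢ ψ r
      free {u} pu e q with u Fin.≟ r
      ... | yes refl = eirr E e
      ... | no ne = proper vψ pr pu e (sym (trans (sym (trans (eq (pu , ne)) (eq₀ (pu , ne)))) q))
      agree : (χ [ r ↦ ψ r ]) ≗[ P ] ψ
      agree {u} pu with u Fin.≟ r
      ... | yes refl = refl
      ... | no ne = trans (eq (pu , ne)) (eq₀ (pu , ne))

-- Fixing the colour of one or two vertices

module _ {n : ℕ} where

  without : ℕ → List ℕ → List ℕ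
  without c = filter (λ d → ¬? (d ≟ c))

  length-without : ∀ {c xs} → Unique xs → length xs ≤ suc (length (without c xs))
  length-without {c} {xs} u = pigeonhole {ys = c ∷ without c xs} u sub
    where
    sub : ∀ {z} → z ∈ xs → z ∈ c ∷ without c xs
    sub {z} p with z ≟ c
    ... | yes e = here e
    ... | no ne = there (∈-filter⁺ (λ d → ¬? (d ≟ c)) p ne)

  length-without-∉ : ∀ {c xs} → Unique xs → c ∉ xs → length xs ≤ length (without c xs)
  length-without-∉ {c} {xs} u c∉ = pigeonhole {ys = without c xs} u λ p → ∈-filter⁺ (λ d → ¬? (d ≟ c)) p λ { refl → c∉ p }

  -- The lists left once v has received colour c.
  del : Net n → Palette → Fin n → ℕ → Palette
  del E L v c w = if ⌊ edge? E v w ⌋ then without c (L w) else L w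

  module _ {E : Net n} {L : Palette {n}} {v : Fin n} {c : ℕ} where

    del-⊆ : ∀ {w d} → d ∈ del E L v c w → d ∈ L w
    del-⊆ {w} p with edge? E v w
    ... | yes _ = proj₁ (∈-filter⁻ (λ d → ¬? (d ≟ c)) {xs = L w} p)
    ... | no _ = p

    del-≢ : ∀ {w d} → Edge E v w → d ∈ del E L v c w → d ≢ c
    del-≢ {w} e p with edge? E v w
    ... | yes _ = proj₂ (∈-filter⁻ (λ d → ¬? (d ≟ c)) {xs = L w} p)
    ... | no ne = ⊥-elim (ne e)

    ∈-del : ∀ {w d} → d ∈ L w → (Edge E v w → d ≢ c) → d ∈ del E L v c w
    ∈-del {w} p ne with edge? E v w
    ... | yes e = ∈-filter⁺ (λ d → ¬? (d ≟ c)) p (ne e)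
    ... | no _ = p

    del-unique : (∀ w → Unique (L w)) → ∀ w → Unique (del E L v c w)
    del-unique u w with edge? E v w
    ... | yes _ = filter⁺ (λ d → ¬? (d ≟ c)) (u w)
    ... | no _ = u w

    fix-valid : ∀ {P φ} → c ∈ L v → φ v ≡ c → Valid E (del E L v c) (P - v) φ → Valid E L P φ
    fix-valid {P} {φ} cL q V = valid pr li
      where
      pr : ∀ {u w} → P ∋ u → P ∋ w → Edge E u w → φ u ≢ φ w
      pr {u} {w} pu pw e with u Fin.≟ v | w Fin.≟ v
      ... | yes refl | yes refl = ⊥-elim (eirr E e)
      ... | yes refl | no b = λ r → del-≢ {w} e (listed V (pw , b)) (trans (sym r) q)
      ... | no a | yes refl = λ r → del-≢ {u} (esym E e) (listed V (pu , a)) (trans r q)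
      ... | no a | no b = proper V (pu , a) (pw , b) e
      li : ∀ {u} → P ∋ u → φ u ∈ L u
      li {u} pu with u Fin.≟ v
      ... | yes refl = subst (_∈ L u) (sym q) cL
      ... | no a = del-⊆ {u} (listed V (pu , a))

    unfix-valid : ∀ {P φ} → P ∋ v → φ v ≡ c → Valid E L P φ → Valid E (del E L v c) (P - v) φ
    unfix-valid pv q V = valid (λ (pu , _) (pw , _) → proper V pu pw)
      λ {u} (pu , ne) → ∈-del {u} (listed V pu) λ e r → proper V pv pu e (trans q (sym r))

    -- No chain of the move reaches v: if c is α or β, a neighbour of v in W would have colour c
    -- before or after the exchange, but c was deleted from its list.
    fix-move : ∀ {P φ ψ} → P ∋ v → c ∈ L v → φ v ≡ c → Move E (del E L v c) (P - v) φ ψ → Move E L P φ ψ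
    fix-move {P} {φ} {ψ} pv cL q m = record
      { α = α ; β = β ; W = W ; kempe = k ; on = on ; off = off
      ; before = fix-valid cL q before
      ; after = fix-valid cL (trans (off v∉) q) after }
      where
      open Move m
      v∉ : ¬ W ∋ v
      v∉ w = proj₂ (inside kempe w) refl
      k : KempeSet E P φ α β W
      k .inside w = proj₁ (inside kempe w)
      k .bicol = bicol kempe
      k .closed {u} {w} wu e p ab with w Fin.≟ v
      ... | no ne = closed kempe wu e (p , ne) ab
      ... | yes refl = ⊥-elim (del-≢ {u} (esym E e) (listed after (inside kempe wu))
                (trans (on wu) (trans (sym (AB-other (bicol kempe wu) ab differ)) q)))
        where
        differ : φ u ≢ φ w
        differ r = del-≢ {u} (esym E e) (listed before (inside kempe wu)) (trans r q)

    fix-steps : ∀ {P φ ψ} → P ∋ v → c ∈ L v → φ v ≡ c → Steps E (del E L v c) (P - v) φ ψ → Steps E L P φ ψ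
    fix-steps pv cL q ε = ε
    fix-steps pv cL q (m ◅ s) = fix-move pv cL q m ◅
      fix-steps pv cL (trans (Move.off m λ w → proj₂ (inside (Move.kempe m) w) refl) q) s

  record Tight (E : Net n) (L : Palette) (P : VSet n) : Set where
    field
      uniqᵗ  : ∀ v → Unique (L v)
      tightᵗ : ∀ {v} → P ∋ v → deg E P v ≤ length (L v)
  open Tight public

  Slack : Net n → Palette → VSet n → Fin n → Set
  Slack E L P r = P ∋ r × deg E P r < length (L r)

  Conn : Net n → VSet n → Fin n → Set₁
  Conn E P r = ∀ T → T ∋ r → (∀ {u w} → T ∋ u → P ∋ u → Edge E u w → P ∋ w → T ∋ w) → ∀ {w} → P ∋ w → T ∋ w

  mkGood : ∀ {E L P r} → Tight E L P → Slack E L P r → Conn E P r → Good E L P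
  mkGood t (p , d) c = record { uniq = uniqᵗ t ; tight = tightᵗ t ; reach = λ T sl cl → c T (sl p d) cl }

  tight-⊆ : ∀ {E L} P Q → (∀ {u} → Q ∋ u → P ∋ u) → Tight E L P → Tight E L Q
  tight-⊆ {E} P Q sub t = record { uniqᵗ = uniqᵗ t ; tightᵗ = λ q → ≤-trans (deg-mono E Q P sub) (tightᵗ t (sub q)) }

  module _ {E : Net n} {L : Palette {n}} {P : VSet n} {v : Fin n} {c : ℕ} where

    private
      deg-step : ∀ {w} m → P ∋ v → Edge E v w → deg E P w ≤ m → suc (deg E (P - v) w) ≤ m
      deg-step m pv e d = ≤-trans (deg-< E (P - v) P proj₁ (esym E e) pv (λ q → proj₂ q refl)) d

      length-del-same : ∀ {w} → Unique (L w) → (Edge E v w → c ∉ L w) → length (L w) ≤ length (del E L v c w)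
      length-del-same {w} u c∉ with edge? E v w
      ... | yes e = length-without-∉ u (c∉ e)
      ... | no _ = ≤-refl

    tight-fix : P ∋ v → Tight E L P → Tight E (del E L v c) (P - v)
    tight-fix pv t .uniqᵗ = del-unique {E} {L} {v} {c} (uniqᵗ t)
    tight-fix pv t .tightᵗ {w} (p , _) with edge? E v w in eq
    ... | yes e = ≤-pred (≤-trans (deg-step _ pv e (tightᵗ t p)) (length-without (uniqᵗ t w)))
    ... | no _ = ≤-trans (deg-mono E (P - v) P proj₁) (tightᵗ t p)

    slack-keep : ∀ {w} → P ∋ v → w ≢ v → Unique (L w) → Slack E L P w → Slack E (del E L v c) (P - v) w
    slack-keep {w} pv ne u (p , d) with edge? E v w
    ... | yes e = (p , ne) , ≤-pred (≤-trans (s≤s (deg-step _ pv e ≤-refl)) (≤-trans d (length-without u)))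
    ... | no _ = (p , ne) , ≤-trans (s≤s (deg-mono E (P - v) P proj₁)) d

    -- A source of spare colours: w loses the neighbour v but no colour, since c was not in its
    -- list.
    slack-new : ∀ {w} → P ∋ v → Tight E L P → P ∋ w → Edge E v w → c ∉ L w → Slack E (del E L v c) (P - v) w
    slack-new {w} pv t p e c∉ = (p , λ { refl → eirr E e }) ,
      ≤-trans (deg-step _ pv e (tightᵗ t p)) (length-del-same {w} (uniqᵗ t w) (λ _ → c∉))

    fixed-class : ∀ {φ ψ} → Good E (del E L v c) (P - v) → P ∋ v → c ∈ L v →
      Valid E L P φ → Valid E L P ψ → φ v ≡ c → ψ v ≡ c → ∃ λ χ → Steps E L P φ χ × χ ≗[ P ] ψ
    fixed-class {φ} {ψ} g pv cL vφ vψ p q with good-swappable g (unfix-valid pv p vφ) (unfix-valid pv q vψ)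
    ... | χ , s , eq = χ , fix-steps pv cL p s , agree
      where
      keep : ∀ {φ χ} → Steps E (del E L v c) (P - v) φ χ → χ v ≡ φ v
      keep ε = refl
      keep (m ◅ s) = trans (keep s) (Move.off m λ w → proj₂ (inside (Move.kempe m) w) refl)
      agree : χ ≗[ P ] ψ
      agree {u} pu with u Fin.≟ v
      ... | yes refl = trans (keep s) (trans p (sym q))
      ... | no ne = eq (pu , ne)

    fixed-exists : Good E (del E L v c) (P - v) → c ∈ L v → ∃ λ φ → Valid E L P φ × φ v ≡ c
    fixed-exists g cL with good-colorable g
    ... | φ , V = φ [ v ↦ c ] , fix-valid cL (upd-same φ v c) (valid-cong V (λ (_ , ne) → upd-other φ ne)) , upd-same φ v c

  fixed₂-exists : ∀ {E L P u v d c} → Good E (del E (del E L u d) v c) (P - u - v) → d ∈ L u → c ∈ del E L u d v → v ≢ u →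
    ∃ λ φ → Valid E L P φ × φ u ≡ d × φ v ≡ c
  fixed₂-exists {E} {L} {P} {u} {v} {d} {c} g dL cL ne
    with fixed-exists {P = P - u} g cL
  ... | φ , V , q = φ [ u ↦ d ] , fix-valid {E} {L} {u} {d} dL (upd-same φ u d) (valid-cong V (λ (_ , a) → upd-other φ a))
                  , upd-same φ u d , trans (upd-other φ ne) q

  fixed₂-class : ∀ {E L P u v d c φ ψ} → Good E (del E (del E L u d) v c) (P - u - v) → P ∋ u → P ∋ v → v ≢ u →
    d ∈ L u → c ∈ del E L u d v → Valid E L P φ → Valid E L P ψ → φ u ≡ d → ψ u ≡ d → φ v ≡ c → ψ v ≡ c →
    ∃ λ χ → Steps E L P φ χ × χ ≗[ P ] ψ
  fixed₂-class {E} {L} {P} {u} {v} {d} {c} {φ} {ψ} g pu pv ne dL cL vφ vψ φu ψu φv ψv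
    with fixed-class {P = P - u} g (pv , ne) cL (unfix-valid pu φu vφ) (unfix-valid pu ψu vψ) φv ψv
  ... | χ , s , eq = χ , fix-steps pu dL φu s , agree
      where
      keep : ∀ {φ χ} → Steps E (del E L u d) (P - u) φ χ → χ u ≡ φ u
      keep ε = refl
      keep (m ◅ s) = trans (keep s) (Move.off m λ w → proj₂ (inside (Move.kempe m) w) refl)
      agree : χ ≗[ P ] ψ
      agree {w} pw with w Fin.≟ u
      ... | yes refl = trans (keep s) (trans φu (sym ψu))
      ... | no a = eq (pw , a)

-- Passing from `Graph` to `Net`, and from moves back to single Kempe swaps

module _ (G : Graph) where
  open Graph G using (n; adj)

  net : Net n
  net = record
    { Edge = λ u w → adj u w ≡ true ; edge? = λ u w → adj u w Bool.≟ true
    ; esym = λ {u} {w} e → trans (Graph.sym G w u) e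
    ; eirr = λ {v} e → case trans (sym e) (Graph.irrefl G v) of λ () }

  length-filter-tabulate : ∀ {m} {A : Set} {P : A → Set} (P? : ∀ a → Dec (P a)) (f : Fin m → A) →
    length (filter P? (List.tabulate f)) ≡ Subset.∣ Vec.tabulate (does ∘ P? ∘ f) ∣
  length-filter-tabulate {zero} P? f = refl
  length-filter-tabulate {suc m} P? f with P? (f zero)
  ... | yes _ = cong suc (length-filter-tabulate P? (f ∘ suc))
  ... | no _ = length-filter-tabulate P? (f ∘ suc)

  count-cong : ∀ {m} {f g : Fin m → Bool} → (∀ i → f i ≡ g i) → Subset.∣ Vec.tabulate f ∣ ≡ Subset.∣ Vec.tabulate g ∣
  count-cong {zero} eq = refl
  count-cong {suc m} {f} {g} eq rewrite eq zero with g zero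
  ... | true = cong suc (count-cong (eq ∘ suc))
  ... | false = count-cong (eq ∘ suc)

  deg-net : ∀ v → deg net Whole v ≡ degree G v
  deg-net v = trans (length-filter-tabulate (mem? (Nb net Whole v)) id) (count-cong same)
    where
    same : ∀ i → does (mem? (Nb net Whole v) i) ≡ adj v i
    same i with adj v i
    ... | true = refl
    ... | false = refl

  module _ {keep : Fin n → Set} (keep? : ∀ v → Dec (keep v)) where

    path-end : ∀ {u v} → PathIn G keep u v → keep v
    path-end (here k) = k
    path-end (step _ _ k) = k

    path-closed : ∀ (T : VSet n) {u v} → T ∋ u → (∀ {p q} → T ∋ p → keep p → adj p q ≡ true → keep q → T ∋ q) →
      PathIn G keep u v → T ∋ v
    path-closed T t cl (here _) = t
    path-closed T t cl (step p e k) = cl (path-closed T t cl p) (path-end p) e k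

    -- `KempeSwapAt` speaks of paths, so a chain must be turned into a decidable set: the start is
    -- closed up one vertex at a time, and the shrinking complement bounds the process.
    reachable : ∀ {u} → keep u → Σ[ C ∈ VSet n ] (∀ {v} → C ∋ v → PathIn G keep u v) × (∀ {v} → PathIn G keep u v → C ∋ v)
    reachable {u} ku = grow (size (∁ ⟨ u ⟩)) ⟨ u ⟩ ≤-refl refl (λ { refl → here ku })
      where
      grow : ∀ m C → size (∁ C) ≤ m → C ∋ u → (∀ {v} → C ∋ v → PathIn G keep u v) →
        Σ[ C ∈ VSet n ] (∀ {v} → C ∋ v → PathIn G keep u v) × (∀ {v} → PathIn G keep u v → C ∋ v)
      grow m C le cu sound
        with Fin.any? (λ p → Fin.any? (λ q → mem? C p ×-dec ((adj p q Bool.≟ true) ×-dec (keep? q ×-dec ¬? (mem? C q)))))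
      ... | no none = C , sound , path-closed C cu λ {p} {q} cp _ e kq → case mem? C q of
              λ { (yes c) → c ; (no nc) → ⊥-elim (none (p , q , cp , e , kq , nc)) }
      grow zero C le cu sound | yes (p , q , cp , e , kq , nq) =
        contradiction (size-< (∁ (C ∪₁ q)) (∁ C) (λ a b → a (inj₁ b)) nq (λ a → a (inj₂ refl))) (<⇒≱ (s≤s (≤-trans le z≤n)))
      grow (suc m) C le cu sound | yes (p , q , cp , e , kq , nq) =
        grow m (C ∪₁ q) (≤-pred (≤-trans (size-< (∁ (C ∪₁ q)) (∁ C) (λ a b → a (inj₁ b)) nq (λ a → a (inj₂ refl))) le))
          (inj₁ cu) λ { (inj₁ c) → sound c ; (inj₂ refl) → step (sound cp) e kq }

  sw-same : ∀ α c → sw α α c ≡ c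
  sw-same α c with ab? α α c
  ... | yes (inj₁ refl) = sw-α α α
  ... | yes (inj₂ refl) = sw-α α α
  ... | no nab = sw-other nab

  module _ {L : ListAssignment G} (v₀ : Fin n) where

    isL : ∀ {φ} → Valid net L Whole φ → IsLColoring G L φ
    isL V = (λ u v → proper V tt tt) , λ v → listed V tt

    -- Colourings are compared pointwise, so even a change of nothing needs a step: the exchange of
    -- `φ v₀` with itself.
    identity-swap : ∀ {φ ψ} → Valid net L Whole φ → (∀ v → ψ v ≡ φ v) → LSwap G L φ ψ
    identity-swap {φ} {ψ} V eq = (v₀ , φ v₀ , φ v₀ , inj₁ refl , λ v → (λ _ → trans (eq v) (trans (sym (sw-same (φ v₀) (φ v))) (sw-unfold (φ v₀) (φ v₀) (φ v)))) , λ _ → eq v)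
                               , isL (valid-cong {φ = φ} V (λ _ → eq _))

    -- A swap on a union of Kempe chains is carried out one chain at a time.
    kempeSet-swaps : ∀ m {φ ψ α β W} → size W ≤ m → Valid net L Whole φ → KempeSet net Whole φ α β W →
      (∀ {v} → W ∋ v → ψ v ≡ sw α β (φ v)) → (∀ {v} → ¬ W ∋ v → ψ v ≡ φ v) → (∀ {v} → W ∋ v → sw α β (φ v) ∈ L v) →
      LEquivalent G L φ ψ
    kempeSet-swaps m {φ} {ψ} {α} {β} {W} le V k on off inL with Fin.any? (mem? W)
    ... | no none = identity-swap V (λ v → off (λ w → none (v , w))) ◅ ε
    kempeSet-swaps zero {W = W} le V k on off inL | yes (u , wu) =
      contradiction (size-< (W - u) W proj₁ wu (λ q → proj₂ q refl)) (<⇒≱ (s≤s (≤-trans le z≤n)))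
    kempeSet-swaps (suc m) {φ} {ψ} {α} {β} {W} le V k on off inL | yes (u , wu) =
      ((u , α , β , bicol k wu , λ v → (λ p → trans (swapOn-in α β C φ (complete p)) (sw-unfold α β (φ v))) , λ np → swapOn-out α β C φ (np ∘ sound)) , isL V₁)
      ◅ kempeSet-swaps m (≤-pred (≤-trans (size-< W₁ W proj₁ wu (λ q → proj₂ q u∈)) le)) V₁ k₁
          (λ (w , nc) → trans (on w) (cong (sw α β) (sym (swapOn-out α β C φ nc)))) off₁
          (λ {v} (w , nc) → subst (λ z → sw α β z ∈ L v) (sym (swapOn-out α β C φ nc)) (inL w))
      where
      chain : Σ[ C ∈ VSet n ] (∀ {v} → C ∋ v → PathIn G (InAB G φ α β) u v) × (∀ {v} → PathIn G (InAB G φ α β) u v → C ∋ v)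
      chain = reachable (λ v → ab? α β (φ v)) (bicol k wu)
      C : VSet n
      C = proj₁ chain
      sound : ∀ {v} → C ∋ v → PathIn G (InAB G φ α β) u v
      sound = proj₁ (proj₂ chain)
      complete : ∀ {v} → PathIn G (InAB G φ α β) u v → C ∋ v
      complete = proj₂ (proj₂ chain)
      u∈ : C ∋ u
      u∈ = complete (here (bicol k wu))
      C⊆W : ∀ {v} → C ∋ v → W ∋ v
      C⊆W c = path-closed (λ v → ab? α β (φ v)) W wu (λ w _ e ab → closed k w e tt ab) (sound c)
      kC : KempeSet net Whole φ α β C
      kC .inside _ = tt
      kC .bicol c = bicol k (C⊆W c)
      kC .closed c e _ ab = complete (step (sound c) e ab)
      mv : Move net L Whole φ (swapOn α β C φ)
      mv = swapOn-move V kC (inL ∘ C⊆W)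
      V₁ : Valid net L Whole (swapOn α β C φ)
      V₁ = Move.after mv
      W₁ : VSet n
      W₁ = record { Mem = λ v → W ∋ v × ¬ C ∋ v ; mem? = λ v → mem? W v ×-dec ¬? (mem? C v) }
      k₁ : KempeSet net Whole (swapOn α β C φ) α β W₁
      k₁ .inside _ = tt
      k₁ .bicol (w , nc) = subst (AB α β) (sym (swapOn-out α β C φ nc)) (bicol k w)
      k₁ .closed {p} {q} (w , nc) e _ ab with mem? C q
      ... | yes c = ⊥-elim (nc (closed kC c (esym net e) tt (bicol k w)))
      ... | no nq = closed k w e tt ab , nq
      off₁ : ∀ {v} → ¬ W₁ ∋ v → ψ v ≡ swapOn α β C φ v
      off₁ {v} nw with mem? C v
      ... | yes c = on (C⊆W c)
      ... | no nc = off (λ w → nw (w , nc))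

    steps-swaps : ∀ {φ ψ} → Steps net L Whole φ ψ → LEquivalent G L φ ψ
    steps-swaps ε = ε
    steps-swaps (m ◅ s) = kempeSet-swaps (size (Move.W m)) ≤-refl (Move.before m) (Move.kempe m) (Move.on m) (Move.off m)
      (λ {v} w → subst (_∈ L v) (Move.on m w) (listed (Move.after m) tt)) ◅◅ steps-swaps s

-- Fragments and separating pairs

module _ (G : Graph) where
  open Graph G using (n; adj)

  _~_ : Fin n → Fin n → Set
  u ~ w = adj u w ≡ true

  ~sym : ∀ {u w} → u ~ w → w ~ u
  ~sym = esym (net G)

  TwoConnected : Set₁
  TwoConnected = ∀ v (T : VSet n) {t w} → T ∋ t → t ≢ v →
    (∀ {p q} → T ∋ p → p ≢ v → p ~ q → q ≢ v → T ∋ q) → w ≢ v → T ∋ w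

  twoConnected : (∀ x → ConnectedIn G (λ w → w ≢ x)) → TwoConnected
  twoConnected c v T {t} {w} t∈ t≢ cl w≢ = path-closed G (λ u → ¬? (u Fin.≟ v)) T t∈ cl (c v t w t≢ w≢)

  -- Connectedness of A is not demanded; a smallest fragment has it by `connected-inside`.
  Fragment : VSet n → Fin n → Fin n → Set
  Fragment A x y = x ≢ y × ¬ A ∋ x × ¬ A ∋ y × (∃ λ a → A ∋ a) × (∃ λ b → ¬ A ∋ b × b ≢ x × b ≢ y)
    × (∀ u w → A ∋ u → u ~ w → ¬ A ∋ w → w ≡ x ⊎ w ≡ y)

  fragment? : ∀ A x y → Dec (Fragment A x y)
  fragment? A x y = ¬? (x Fin.≟ y) ×-dec ¬? (mem? A x) ×-dec ¬? (mem? A y) ×-dec Fin.any? (mem? A)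
    ×-dec Fin.any? (λ b → ¬? (mem? A b) ×-dec ¬? (b Fin.≟ x) ×-dec ¬? (b Fin.≟ y))
    ×-dec Fin.all? (λ u → Fin.all? λ w → mem? A u →-dec ((adj u w Bool.≟ true) →-dec (¬? (mem? A w) →-dec ((w Fin.≟ x) ⊎-dec (w Fin.≟ y)))))

  fragment-swap : ∀ {A x y} → Fragment A x y → Fragment A y x
  fragment-swap (ne , nx , ny , a , (b , nb , bx , by) , bd) =
    ≢-sym ne , ny , nx , a , (b , nb , by , bx) , λ u w au e nw → swap (bd u w au e nw)

  fragment-cong : ∀ {A A′ x y} → (∀ {v} → A ∋ v → A′ ∋ v) → (∀ {v} → A′ ∋ v → A ∋ v) → Fragment A x y → Fragment A′ x y
  fragment-cong to from (ne , nx , ny , (a , pa) , (b , nb , bx , by) , bd) =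
    ne , nx ∘ from , ny ∘ from , (a , to pa) , (b , nb ∘ from , bx , by) , λ u w au e nw → bd u w (from au) e (nw ∘ to)

  ofSubset : Subset n → VSet n
  ofSubset S = record { Mem = λ v → Vec.lookup S v ≡ true ; mem? = λ v → Vec.lookup S v Bool.≟ true }

  toSubset : VSet n → Subset n
  toSubset A = Vec.tabulate λ v → does (mem? A v)

  toSubset⁺ : ∀ A {v} → A ∋ v → ofSubset (toSubset A) ∋ v
  toSubset⁺ A {v} a = trans (lookup∘tabulate _ v) (dec-true (mem? A v) a)

  toSubset⁻ : ∀ A {v} → ofSubset (toSubset A) ∋ v → A ∋ v
  toSubset⁻ A {v} p with mem? A v | trans (sym (lookup∘tabulate (λ v → does (mem? A v)) v)) p
  ... | yes a | _ = a

  -- The search runs over `Subset n`, which can be enumerated, whereas `VSet n` cannot.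
  anyFragment? : ∀ m → Dec (∃ λ S → ∃₂ λ x y → Fragment (ofSubset S) x y × size (ofSubset S) < m)
  anyFragment? m = anySubset? λ S → Fin.any? λ x → Fin.any? λ y → fragment? (ofSubset S) x y ×-dec (size (ofSubset S) <? m)

  SmallestFragment : VSet n → Fin n → Fin n → Set₁
  SmallestFragment A x y = Fragment A x y × (∀ A′ {x′ y′} → Fragment A′ x′ y′ → size A ≤ size A′)

  smallest-fragment : ∀ {A x y} → Fragment A x y → Σ[ A ∈ VSet n ] Σ[ x ∈ Fin n ] Σ[ y ∈ Fin n ] SmallestFragment A x y
  smallest-fragment {A} f = go (size A) f ≤-refl
    where
    go : ∀ m {A x y} → Fragment A x y → size A ≤ m → Σ[ A ∈ VSet n ] Σ[ x ∈ Fin n ] Σ[ y ∈ Fin n ] SmallestFragment A x y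
    go m {A} {x} {y} f le with anyFragment? (size A)
    ... | no none = A , x , y , f , λ A′ {x′} {y′} f′ → ≮⇒≥ λ lt →
            none (toSubset A′ , x′ , y′ , fragment-cong {A′} {ofSubset (toSubset A′)} (toSubset⁺ A′) (toSubset⁻ A′) f′
                 , ≤-trans (s≤s (size-mono (ofSubset (toSubset A′)) A′ (toSubset⁻ A′))) lt)
    go zero f le | yes (_ , _ , _ , _ , lt) = contradiction lt (<⇒≱ (s≤s (≤-trans le z≤n)))
    go (suc m) f le | yes (S , _ , _ , f′ , lt) = go m f′ (≤-pred (≤-trans lt le))

  -- The cut is given only as a negation, so the fragment is found by search: if there were none,
  -- the set reachable from u would contain every admissible v.
  fragment-of-cut : ∀ {x y} → x ≢ y → ¬ ConnectedIn G (λ w → w ≢ x × w ≢ y) → Σ[ A ∈ VSet n ] Fragment A x y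
  fragment-of-cut {x} {y} x≢y dis with anySubset? (λ S → fragment? (ofSubset S) x y)
  ... | yes (S , f) = ofSubset S , f
  ... | no none = ⊥-elim (dis connected)
    where
    keep? : ∀ w → Dec (w ≢ x × w ≢ y)
    keep? w = ¬? (w Fin.≟ x) ×-dec ¬? (w Fin.≟ y)
    connected : ConnectedIn G (λ w → w ≢ x × w ≢ y)
    connected u v ku kv with reachable G keep? ku
    ... | C , sound , complete with mem? C v
    ... | yes c = sound c
    ... | no nc = ⊥-elim (none (toSubset C , fragment-cong {C} {ofSubset (toSubset C)} (toSubset⁺ C) (toSubset⁻ C)
          ( x≢y , (λ c → proj₁ (path-end G keep? (sound c)) refl) , (λ c → proj₂ (path-end G keep? (sound c)) refl)
          , (u , complete (here ku)) , (v , nc , kv) , bd)))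
      where
      bd : ∀ u w → C ∋ u → u ~ w → ¬ C ∋ w → w ≡ x ⊎ w ≡ y
      bd u w cu e nw with w Fin.≟ x | w Fin.≟ y
      ... | yes p | _ = inj₁ p
      ... | no _ | yes q = inj₂ q
      ... | no p | no q = ⊥-elim (nw (complete (step (sound cu) e (p , q))))

  module Cut (2conn : TwoConnected) (deg≥3 : ∀ v → 3 ≤ deg (net G) Whole v) where

    third-neighbour : ∀ v p q → ∃ λ w → v ~ w × w ≢ p × w ≢ q
    third-neighbour v p q with Fin.any? (λ w → (adj v w Bool.≟ true) ×-dec ¬? (w Fin.≟ p) ×-dec ¬? (w Fin.≟ q))
    ... | yes r = r
    ... | no none = contradiction (deg≥3 v) (<⇒≱ (s≤s (pigeonhole {ys = p ∷ q ∷ []} (members-unique (Nb (net G) Whole v)) sub)))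
      where
      sub : ∀ {w} → w ∈ members (Nb (net G) Whole v) → w ∈ p ∷ q ∷ []
      sub {w} m with w Fin.≟ p | w Fin.≟ q
      ... | yes refl | _ = here refl
      ... | no _ | yes refl = there (here refl)
      ... | no a | no b = ⊥-elim (none (w , proj₁ (members-∈ (Nb (net G) Whole v) m) , a , b))

    -- Otherwise the single vertex y would separate A from x.
    neighbour-inside : ∀ {A x y} → Fragment A x y → ∃ λ a → A ∋ a × x ~ a
    neighbour-inside {A} {x} {y} (ne , nx , ny , (a , pa) , _ , bd)
      with Fin.any? (λ a → mem? A a ×-dec (adj x a Bool.≟ true))
    ... | yes r = r
    ... | no none = ⊥-elim (nx (2conn y A pa (λ { refl → ny pa }) cl ne))
      where
      cl : ∀ {p q} → A ∋ p → p ≢ y → p ~ q → q ≢ y → A ∋ q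
      cl {p} {q} ap _ e q≢ with mem? A q
      ... | yes aq = aq
      ... | no nq with bd p q ap e nq
      ...   | inj₁ refl = ⊥-elim (none (p , ap , ~sym e))
      ...   | inj₂ r = ⊥-elim (q≢ r)

    opposite : VSet n → Fin n → Fin n → VSet n
    opposite A x y = ∁ A - x - y

    fragment-opposite : ∀ {A x y} → Fragment A x y → Fragment (opposite A x y) x y
    fragment-opposite {A} {x} {y} (ne , nx , ny , (a , pa) , (b , nb , bx , by) , bd) =
      ne , (λ ((_ , p) , _) → p refl) , (λ (_ , p) → p refl) , (b , (nb , bx) , by)
      , (a , (λ ((q , _) , _) → q pa) , (λ { refl → nx pa }) , λ { refl → ny pa }) , bd′
      where
      bd′ : ∀ u w → opposite A x y ∋ u → u ~ w → ¬ opposite A x y ∋ w → w ≡ x ⊎ w ≡ y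
      bd′ u w ((nu , ux) , uy) e nw with w Fin.≟ x | w Fin.≟ y | mem? A w
      ... | yes p | _ | _ = inj₁ p
      ... | no _ | yes q | _ = inj₂ q
      ... | no p | no q | no nA = ⊥-elim (nw ((nA , p) , q))
      ... | no p | no q | yes aw = ⊥-elim ([ ux , uy ]′ (bd w u aw (~sym e) nu))

    neighbour-outside : ∀ {A x y} → Fragment A x y → ∃ λ b → (¬ A ∋ b × b ≢ y) × x ~ b
    neighbour-outside {A} {x} {y} f with neighbour-inside {opposite A x y} (fragment-opposite {A} f)
    ... | b , ((nb , _) , by) , e = b , (nb , by) , e

    module Smallest {A : VSet n} {x y : Fin n} (sf : SmallestFragment A x y) where

      frag : Fragment A x y
      frag = proj₁ sf
      x≢y : x ≢ y
      x≢y = proj₁ frag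
      x∉A : ¬ A ∋ x
      x∉A = proj₁ (proj₂ frag)
      y∉A : ¬ A ∋ y
      y∉A = proj₁ (proj₂ (proj₂ frag))
      boundary : ∀ {u w} → A ∋ u → u ~ w → ¬ A ∋ w → w ≡ x ⊎ w ≡ y
      boundary = proj₂ (proj₂ (proj₂ (proj₂ (proj₂ frag)))) _ _

      not-smaller : ∀ S {p q z} → Fragment S p q → (∀ {u} → S ∋ u → A ∋ u) → A ∋ z → ¬ S ∋ z → ⊥
      not-smaller S f sub az nz = <⇒≱ (size-< S A sub az nz) (proj₂ sf S f)

      -- If a were the only neighbour of x in A, then {a , y} would cut off `A - a`. That set is
      -- nonempty, because a has a neighbour besides x and y.
      two-neighbours : ∀ p → ∃ λ a → A ∋ a × x ~ a × a ≢ p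
      two-neighbours p with Fin.any? (λ a → mem? A a ×-dec (adj x a Bool.≟ true) ×-dec ¬? (a Fin.≟ p))
      ... | yes r = r
      ... | no none with neighbour-inside {A} frag
      ...   | a , pa , e with a Fin.≟ p
      ...     | no ne = ⊥-elim (none (a , pa , e , ne))
      ...     | yes refl with third-neighbour a x y
      ...       | z , ez , zx , zy = ⊥-elim (not-smaller (A - a)
                    ( (λ { refl → y∉A pa }) , (λ q → proj₂ q refl) , y∉A ∘ proj₁ , (z , az , λ { refl → eirr (net G) ez })
                    , (x , x∉A ∘ proj₁ , (λ { refl → x∉A pa }) , x≢y) , bd) proj₁ pa (λ q → proj₂ q refl))
        where
        az : A ∋ z
        az with mem? A z
        ... | yes p = p
        ... | no nz = ⊥-elim ([ zx , zy ]′ (boundary pa ez nz))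
        bd : ∀ u w → (A - a) ∋ u → u ~ w → ¬ (A - a) ∋ w → w ≡ a ⊎ w ≡ y
        bd u w (au , ne) e nw with w Fin.≟ a | mem? A w
        ... | yes q | _ = inj₁ q
        ... | no q | yes aw = ⊥-elim (nw (aw , q))
        ... | no q | no naw with boundary au e naw
        ...   | inj₁ refl = ⊥-elim (none (u , au , ~sym e , ne))
        ...   | inj₂ r = inj₂ r

      -- A part of A that is closed under edges within A is itself cut off by {x , y}, so by
      -- minimality it is all of A.
      connected-inside : ∀ {r} → A ∋ r → Conn (net G) A r
      connected-inside {r} ar T tr cl {w} aw with mem? T w
      ... | yes t = t
      ... | no nt = ⊥-elim (not-smaller S
              ( x≢y , x∉A ∘ proj₁ , y∉A ∘ proj₁ , (r , ar , tr)
              , (w , nt ∘ proj₂ , (λ { refl → x∉A aw }) , λ { refl → y∉A aw }) , bd) proj₁ aw (nt ∘ proj₂))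
        where
        S : VSet n
        S = record { Mem = λ v → A ∋ v × T ∋ v ; mem? = λ v → mem? A v ×-dec mem? T v }
        bd : ∀ u w → S ∋ u → u ~ w → ¬ S ∋ w → w ≡ x ⊎ w ≡ y
        bd u w (au , tu) e nw with mem? A w
        ... | yes aw = ⊥-elim (nw (aw , cl tu au e aw))
        ... | no naw = boundary au e naw

    module _ {A : VSet n} {x y : Fin n} (sf : SmallestFragment A x y) where
      open Smallest sf

      not-both : ∀ {u w} → ¬ A ∋ u → u ≢ x → u ≢ y → u ~ w → ¬ A ∋ w
      not-both nu ux uy e aw = [ ux , uy ]′ (boundary aw (~sym e) nu)

      record Separation (a v : Fin n) (S₁ S₂ : VSet n) : Set where
        field
          a∉₁   : ¬ S₁ ∋ a
          v∉₁   : ¬ S₁ ∋ v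
          a∉₂   : ¬ S₂ ∋ a
          v∉₂   : ¬ S₂ ∋ v
          disj  : ∀ {u} → S₁ ∋ u → ¬ S₂ ∋ u
          cover : ∀ u → u ≢ a → u ≢ v → S₁ ∋ u ⊎ S₂ ∋ u
          noedge : ∀ {u w} → S₁ ∋ u → S₂ ∋ w → ¬ u ~ w
          some₁ : ∃ λ u → S₁ ∋ u
          some₂ : ∃ λ u → S₂ ∋ u
      open Separation

      separation-swap : ∀ {a v S₁ S₂} → Separation a v S₁ S₂ → Separation a v S₂ S₁
      separation-swap s = record
        { a∉₁ = a∉₂ s ; v∉₁ = v∉₂ s ; a∉₂ = a∉₁ s ; v∉₂ = v∉₁ s ; disj = λ p q → disj s q p
        ; cover = λ u p q → swap (cover s u p q) ; noedge = λ p q e → noedge s q p (~sym e)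
        ; some₁ = some₂ s ; some₂ = some₁ s }

      -- Such a side would be a fragment with cut {a , v}, smaller than A because it misses a.
      side-outside : ∀ {a v S₁ S₂} → A ∋ a → a ≢ v → Separation a v S₁ S₂ → ¬ (∀ {u} → S₂ ∋ u → A ∋ u)
      side-outside {a} {v} {S₁} {S₂} pa ne s sub = not-smaller S₂
        ( ne , a∉₂ s , v∉₂ s , some₂ s
        , (proj₁ (some₁ s) , disj s (proj₂ (some₁ s))
          , (λ { refl → a∉₁ s (proj₂ (some₁ s)) }) , λ { refl → v∉₁ s (proj₂ (some₁ s)) })
        , bd) sub pa (a∉₂ s)
        where
        bd : ∀ u w → S₂ ∋ u → u ~ w → ¬ S₂ ∋ w → w ≡ a ⊎ w ≡ v
        bd u w su e nw with w Fin.≟ a | w Fin.≟ v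
        ... | yes p | _ = inj₁ p
        ... | no _ | yes q = inj₂ q
        ... | no p | no q with cover s w p q
        ...   | inj₁ s₁ = ⊥-elim (noedge s s₁ su (~sym e))
        ...   | inj₂ s₂ = ⊥-elim (nw s₂)

      beyond : VSet n → VSet n
      beyond S = record { Mem = λ u → S ∋ u × ¬ A ∋ u × u ≢ y ; mem? = λ u → mem? S u ×-dec ¬? (mem? A u) ×-dec ¬? (u Fin.≟ y) }

      -- The hypotheses place x, y and v so that an edge can leave `beyond S₂` only towards p: its
      -- vertices are neither x nor y and so have no neighbour in A, and no edge joins S₂ to S₁.
      -- Hence p alone would separate it from the vertex of S₁ that differs from p.
      beyond-empty : ∀ {a v S₁ S₂} p → A ∋ a → Separation a v S₁ S₂ → (y ≡ p ⊎ S₁ ∋ y) → (∃ λ q → q ≢ p × S₁ ∋ q) →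
        (x ≡ v ⊎ S₁ ∋ x) → (A ∋ v ⊎ v ≡ p) → ∀ {z} → z ≢ p → ¬ beyond S₂ ∋ z
      beyond-empty {a} {v} {S₁} {S₂} p pa s hy (q₀ , q≢ , s₁q) hx hv z≢ bz =
        disj s s₁q (proj₁ (2conn p (beyond S₂) bz z≢ cl q≢))
        where
        u≢x : ∀ {u} → S₂ ∋ u → u ≢ x
        u≢x su refl = [ (λ { refl → v∉₂ s su }) , (λ s₁ → disj s s₁ su) ]′ hx
        w≢y : ∀ {u w} → S₂ ∋ u → u ~ w → w ≢ p → w ≢ y
        w≢y su e w≢ refl = [ w≢ , (λ s₁ → noedge s s₁ su (~sym e)) ]′ hy
        cl : ∀ {u w} → beyond S₂ ∋ u → u ≢ p → u ~ w → w ≢ p → beyond S₂ ∋ w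
        cl {u} {w} (su , nu , uy) _ e w≢
          with not-both nu (u≢x su) uy e
        ... | naw with cover s w (λ { refl → naw pa }) (λ { refl → [ naw , w≢ ]′ hv })
        ...   | inj₁ s₁ = ⊥-elim (noedge s s₁ su (~sym e))
        ...   | inj₂ s₂ = s₂ , naw , w≢y su e w≢

      -- If x and y are on one side, the other side lies in A. If they are on different sides, a
      -- neighbour of y outside A lies on the side of y, where y alone cuts it off from x.
      no-separation-∈ : ∀ {a v S₁ S₂} → A ∋ a → a ≢ v → A ∋ v → ¬ Separation a v S₁ S₂
      no-separation-∈ {a} {v} {S₁} {S₂} pa ne pv s =
        [ (λ s₁ → go s s₁) , (λ s₂ → go (separation-swap s) s₂) ]′ (cover s x (λ { refl → x∉A pa }) (λ { refl → x∉A pv }))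
        where
        go : ∀ {S₁ S₂} → Separation a v S₁ S₂ → S₁ ∋ x → ⊥
        go {S₁} {S₂} s s₁x = case cover s y (λ { refl → y∉A pa }) (λ { refl → y∉A pv }) of
          λ { (inj₁ s₁y) → side-outside pa ne s λ {u} su → case mem? A u of
                λ { (yes au) → au ; (no nu) → ⊥-elim (empty (su , nu , λ { refl → disj s s₁y su })) }
            ; (inj₂ s₂y) → y-side s₂y }
          where
          empty : ∀ {z} → ¬ beyond S₂ ∋ z
          empty bz = beyond-empty y pa s (inj₁ refl) (x , x≢y , s₁x) (inj₂ s₁x) (inj₁ pv) (proj₂ (proj₂ bz)) bz
          y-side : ¬ S₂ ∋ y
          y-side s₂y with neighbour-outside {A} (fragment-swap {A} frag)
          ... | b , (nb , _) , e with cover s b (λ { refl → nb pa }) (λ { refl → nb pv })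
          ...   | inj₁ s₁ = noedge s s₁ s₂y (~sym e)
          ...   | inj₂ s₂ = empty (s₂ , nb , λ { refl → eirr (net G) e })

      no-separation-x : ∀ {a S₁ S₂} → A ∋ a → ¬ Separation a x S₁ S₂
      no-separation-x {a} pa s =
        [ go s , go (separation-swap s) ]′ (cover s y (λ { refl → y∉A pa }) (λ q → x≢y (sym q)))
        where
        go : ∀ {S₁ S₂} → Separation a x S₁ S₂ → ¬ S₁ ∋ y
        go {S₁} {S₂} s s₁y = side-outside pa (λ { refl → x∉A pa }) s λ {u} su → case mem? A u of
          λ { (yes au) → au
            ; (no nu) → ⊥-elim (beyond-empty x pa s (inj₂ s₁y) (y , (λ q → x≢y (sym q)) , s₁y) (inj₁ refl) (inj₂ refl)
                (λ { refl → v∉₂ s su }) (su , nu , λ { refl → disj s s₁y su })) }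

      -- Uncrossing of two cuts: the common part of A and S₁ can be left only through x and a, and
      -- it is smaller than A because it misses a.
      corner-empty : ∀ {a v S₁ S₂} → A ∋ a → Separation a v S₁ S₂ → S₁ ∋ x → S₂ ∋ y → ¬ A ∋ v → ∀ {u} → S₁ ∋ u → ¬ A ∋ u
      corner-empty {a} {v} {S₁} {S₂} pa s s₁x s₂y nv {u} s₁u au = not-smaller S
        ( (λ { refl → x∉A pa }) , x∉A ∘ proj₁ , a∉₁ s ∘ proj₂ , (u , au , s₁u)
        , (y , y∉A ∘ proj₁ , (λ q → x≢y (sym q)) , λ { refl → y∉A pa }) , bd) proj₁ pa (a∉₁ s ∘ proj₂)
        where
        S : VSet n
        S = record { Mem = λ v → A ∋ v × S₁ ∋ v ; mem? = λ v → mem? A v ×-dec mem? S₁ v }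
        bd : ∀ u w → S ∋ u → u ~ w → ¬ S ∋ w → w ≡ x ⊎ w ≡ a
        bd u w (au , su) e nw with mem? A w | w Fin.≟ a
        ... | yes _ | yes q = inj₂ q
        ... | yes aw | no q = case cover s w q (λ { refl → nv aw }) of
              λ { (inj₁ s₁) → ⊥-elim (nw (aw , s₁)) ; (inj₂ s₂) → ⊥-elim (noedge s su s₂ e) }
        ... | no naw | _ = case boundary au e naw of
              λ { (inj₁ q) → inj₁ q ; (inj₂ refl) → ⊥-elim (noedge s su s₂y e) }

    smallest-swap : ∀ {A x y} → SmallestFragment A x y → SmallestFragment A y x
    smallest-swap {A} (f , m) = fragment-swap {A} f , m

    module _ {A : VSet n} {x y : Fin n} (sf : SmallestFragment A x y) where
      open Smallest sf
      open Separation

      no-separation : ∀ {a v S₁ S₂} → A ∋ a → a ≢ v → ¬ Separation sf a v S₁ S₂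
      no-separation {a} {v} {S₁} {S₂} pa ne s with mem? A v | v Fin.≟ x | v Fin.≟ y
      ... | yes pv | _ | _ = no-separation-∈ sf pa ne pv s
      ... | no _ | yes refl | _ = no-separation-x sf pa s
      ... | no _ | no _ | yes refl = no-separation-x (smallest-swap sf) pa s′
        where
        s′ : Separation (smallest-swap sf) a y S₁ S₂
        s′ = record { Separation s }
      ... | no nv | no vx | no vy =
        [ go s , go (separation-swap sf s) ]′ (cover s x (λ { refl → x∉A pa }) (≢-sym vx))
        where
        go : ∀ {S₁ S₂} → Separation sf a v S₁ S₂ → ¬ S₁ ∋ x
        go {S₁} {S₂} s s₁x = case cover s y (λ { refl → y∉A pa }) (≢-sym vy) of
          λ { (inj₁ s₁y) → side-outside sf pa ne s λ {u} su → case mem? A u of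
                λ { (yes au) → au
                  ; (no nu) → ⊥-elim (beyond-empty sf v pa s (inj₂ s₁y) (x , ≢-sym vx , s₁x) (inj₂ s₁x) (inj₂ refl)
                      (λ { refl → v∉₂ s su }) (su , nu , λ { refl → disj s s₁y su })) }
            ; (inj₂ s₂y) → corners s₂y }
          where
          corners : ¬ S₂ ∋ y
          -- The neighbour z of a lies in A, hence in one of the two corners of A, and both corners
          -- are empty.
          corners s₂y with third-neighbour a x y
          ... | z , e , zx , zy with mem? A z
          ...   | no nz = [ zx , zy ]′ (boundary pa e nz)
          ...   | yes az with cover s z (λ { refl → eirr (net G) e }) (λ { refl → nv az })
          ...     | inj₁ s₁ = corner-empty sf pa s s₁x s₂y nv s₁ az
          ...     | inj₂ s₂ = corner-empty (smallest-swap sf) pa s″ s₂y s₁x nv s₂ az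
            where
            s″ : Separation (smallest-swap sf) a v S₂ S₁
            s″ = record { Separation (separation-swap sf s) }

      connected-without : ∀ {a v r} → A ∋ a → a ≢ v → r ≢ a → r ≢ v → Conn (net G) (Whole - a - v) r
      connected-without {a} {v} {r} pa ne ra rv T tr cl {w} ((_ , wa) , wv) with mem? T w
      ... | yes t = t
      ... | no nt = ⊥-elim (no-separation {S₁ = S₁} {S₂} pa ne record
            { a∉₁ = λ (_ , p , _) → p refl ; v∉₁ = λ (_ , _ , p) → p refl
            ; a∉₂ = λ (_ , p , _) → p refl ; v∉₂ = λ (_ , _ , p) → p refl
            ; disj = λ (p , _) (q , _) → q p
            ; cover = λ u ua uv → case mem? T u of λ { (yes t) → inj₁ (t , ua , uv) ; (no q) → inj₂ (q , ua , uv) }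
            ; noedge = λ (t , ua , uv) (nt , wa , wv) e → nt (cl t ((tt , ua) , uv) e ((tt , wa) , wv))
            ; some₁ = r , tr , ra , rv ; some₂ = w , nt , wa , wv })
        where
        S₁ S₂ : VSet n
        S₁ = record { Mem = λ u → T ∋ u × u ≢ a × u ≢ v ; mem? = λ u → mem? T u ×-dec ¬? (u Fin.≟ a) ×-dec ¬? (u Fin.≟ v) }
        S₂ = record { Mem = λ u → ¬ T ∋ u × u ≢ a × u ≢ v ; mem? = λ u → ¬? (mem? T u) ×-dec ¬? (u Fin.≟ a) ×-dec ¬? (u Fin.≟ v) }

-- Loose colours of a fixed list-assignment

module Assignment (G : Graph) (2conn : TwoConnected G) (k : ℕ) (reg : ∀ v → deg (net G) Whole v ≡ k)
             (L : ListAssignment G) (uniq : ∀ v → Unique (L v)) (len : ∀ v → length (L v) ≡ k) where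
  open Graph G using (n; adj)

  N : Net n
  N = net G

  infix 4 _∼_ _≈_
  _∼_ : Fin n → Fin n → Set
  u ∼ w = adj u w ≡ true

  ∼sym : ∀ {u w} → u ∼ w → w ∼ u
  ∼sym = esym N

  Proper : Colouring {n} → Set
  Proper = Valid N L Whole

  _≈_ : Colouring {n} → Colouring {n} → Set₁
  _≈_ = Steps N L Whole

  agree-≈ : ∀ {φ χ ψ} → Proper φ → φ ≈ χ → χ ≗[ Whole ] ψ → φ ≈ ψ
  agree-≈ V s eq = s ◅◅ (identity-move (steps-valid V s) (λ v → sym (eq tt)) ◅ ε)

  tightG : Tight N L Whole
  tightG = record { uniqᵗ = uniq ; tightᵗ = λ {v} _ → ≤-reflexive (trans (reg v) (sym (len v))) }

  Sub : Fin n → Fin n → Set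
  Sub u w = ∀ c → c ∈ L u → c ∈ L w

  sub-or-not : ∀ u w → Sub u w ⊎ (∃ λ c → c ∈ L u × c ∉ L w)
  sub-or-not u w = case subset-or-not (L u) (L w) of λ { (inj₁ s) → inj₁ (λ _ → s) ; (inj₂ r) → inj₂ r }

  sub? : ∀ u w → Dec (Sub u w)
  sub? u w = case sub-or-not u w of λ { (inj₁ s) → yes s ; (inj₂ (c , p , q)) → no λ s → q (s c p) }

  sub-sym : ∀ {u w} → Sub u w → Sub w u
  sub-sym {u} {w} s c = ⊆-of-equal-length (uniq u) (≤-reflexive (trans (len w) (sym (len u)))) (s _)

  difference : ∀ {u w c} → c ∈ L u → c ∉ L w → ∃ λ d → d ∈ L w × d ∉ L u
  difference {u} {w} p q = case sub-or-not w u of λ { (inj₁ s) → ⊥-elim (q (sub-sym s _ p)) ; (inj₂ r) → r }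

  Loose : Fin n → ℕ → Set
  Loose v c = c ∈ L v × ∃ λ w → v ∼ w × c ∉ L w

  good-loose : ∀ {v c} → Loose v c → Good N (del N L v c) (Whole - v)
  good-loose {v} {c} (cL , w , e , c∉) =
    mkGood (tight-fix tt tightG) (slack-new tt tightG tt e c∉)
      λ T t cl (_ , w≢) → 2conn v T t (λ { refl → eirr N e }) (λ p p≢ e q≢ → cl p (tt , p≢) e (tt , q≢)) w≢

  loose-class : ∀ {v c φ ψ} → Loose v c → Proper φ → Proper ψ → φ v ≡ c → ψ v ≡ c → φ ≈ ψ
  loose-class l vφ vψ p q with fixed-class (good-loose l) tt (proj₁ l) vφ vψ p q
  ... | χ , s , eq = agree-≈ vφ s eq

  loose-exists : ∀ {v c} → Loose v c → ∃ λ φ → Proper φ × φ v ≡ c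
  loose-exists l = fixed-exists (good-loose l) (proj₁ l)

  Nonloose : Colouring {n} → Set
  Nonloose φ = ∀ {z w} → z ∼ w → φ z ∈ L w

  nonloose-or : ∀ {φ} → Proper φ → Nonloose φ ⊎ (∃ λ z → Loose z (φ z))
  nonloose-or {φ} V with Fin.any? (λ z → Fin.any? λ w → (adj z w Bool.≟ true) ×-dec ¬? (φ z ∈? L w))
  ... | yes (z , w , e , q) = inj₂ (z , listed V tt , w , e , q)
  ... | no none = inj₁ λ {z} {w} e → case φ z ∈? L w of λ { (yes p) → p ; (no q) → ⊥-elim (none (z , w , e , q)) }

  -- In a colouring without loose vertices every Kempe chain with at least two vertices can be swapped.
  nonloose-reaches : ∀ {φ v c} → Proper φ → Nonloose φ → c ∈ L v → ∃ λ ψ → φ ≈ ψ × ψ v ≡ c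
  nonloose-reaches {φ} {v} {c} V nl cL =
    swapOn (φ v) c W φ , swapOn-move V kW proj₂ ◅ ε
    , trans (swapOn-in (φ v) c W φ (inj₁ refl , subst (_∈ L v) (sym (sw-α (φ v) c)) cL)) (sw-α (φ v) c)
    where
    W : VSet n
    W = record { Mem = λ u → AB (φ v) c (φ u) × sw (φ v) c (φ u) ∈ L u
               ; mem? = λ u → ab? (φ v) c (φ u) ×-dec (sw (φ v) c (φ u) ∈? L u) }
    kW : KempeSet N Whole φ (φ v) c W
    kW .inside _ = tt
    kW .bicol = proj₁
    -- Being adjacent to u in a chain, w receives the colour of u, which `nl` puts into its list.
    kW .closed {u} {w} (ab , _) e _ abw = abw , subst (_∈ L w) (AB-other abw ab (proper V tt tt (∼sym e))) (nl e)

  ≈-sym : ∀ {φ ψ} → φ ≈ ψ → ψ ≈ φ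
  ≈-sym = steps-inverse

  Classes : Colouring {n} → Set₁
  Classes φ₀ = ∀ v c φ → Loose v c → Proper φ → φ v ≡ c → φ ≈ φ₀

  all-equivalent : ∀ {φ₀ v c} → Loose v c →
    Classes φ₀ → ∀ φ → Proper φ → φ ≈ φ₀
  all-equivalent l classes φ V with nonloose-or V
  ... | inj₂ (z , lz) = classes _ _ _ lz V refl
  ... | inj₁ nl with nonloose-reaches V nl (proj₁ l)
  ...   | ψ , s , q = s ◅◅ classes _ _ _ l (steps-valid V s) q

  -- Colourings that share a loose pair are equivalent, so it is enough that φ₀ reaches one
  -- colouring for each loose pair.
  reached-classes : ∀ {φ₀} → Proper φ₀ → (∀ {v c} → Loose v c → ∃ λ ψ → φ₀ ≈ ψ × ψ v ≡ c) →
    Classes φ₀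
  reached-classes V₀ h _ _ _ l V q with h l
  ... | ψ , s , r = loose-class l V (steps-valid V₀ s) q r ◅◅ ≈-sym s

  deg-miss : ∀ P {v z} → v ∼ z → ¬ P ∋ z → deg N P v < k
  deg-miss P {v} e nz = subst (deg N P v <_) (reg v) (deg-< N P Whole (λ _ → tt) e tt nz)

  deg-miss₂ : ∀ P {v z z′} → v ∼ z → ¬ P ∋ z → v ∼ z′ → ¬ P ∋ z′ → z ≢ z′ → suc (deg N P v) < k
  deg-miss₂ P {v} {z} {z′} e nz e′ nz′ ne =
    ≤-trans (s≤s (deg-< N P (P ∪₁ z) inj₁ e (inj₂ refl) nz)) (deg-miss (P ∪₁ z) e′ [ nz′ , (λ q → ne (sym q)) ]′)

  swapOn-same : ∀ α β (W W′ : VSet n) φ {v} → (W ∋ v → W′ ∋ v) → (W′ ∋ v → W ∋ v) → swapOn α β W φ v ≡ swapOn α β W′ φ v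
  swapOn-same α β W W′ φ {v} to from with mem? W v
  ... | yes w = sym (swapOn-in α β W′ φ (to w))
  ... | no nw = sym (swapOn-out α β W′ φ (nw ∘ from))

  -- Lifting Kempe changes across a separating pair

  record Split (x y : Fin n) (R : VSet n) : Set where
    field
      x≢y : x ≢ y
      x∉R : ¬ R ∋ x
      y∉R : ¬ R ∋ y
      rim : ∀ {u w} → R ∋ u → u ∼ w → ¬ R ∋ w → w ≡ x ⊎ w ≡ y

  joined : ∀ x y → x ≢ y → Net n
  joined x y ne = record
    { Edge = λ u w → u ∼ w ⊎ (u ≡ x × w ≡ y ⊎ u ≡ y × w ≡ x)
    ; edge? = λ u w → (adj u w Bool.≟ true) ⊎-dec (((u Fin.≟ x) ×-dec (w Fin.≟ y)) ⊎-dec ((u Fin.≟ y) ×-dec (w Fin.≟ x)))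
    ; esym = λ { (inj₁ e) → inj₁ (∼sym e) ; (inj₂ (inj₁ (p , q))) → inj₂ (inj₂ (q , p)) ; (inj₂ (inj₂ (p , q))) → inj₂ (inj₁ (q , p)) }
    ; eirr = λ { (inj₁ e) → eirr N e ; (inj₂ (inj₁ (p , q))) → ne (trans (sym p) q) ; (inj₂ (inj₂ (p , q))) → ne (trans (sym q) p) } }

  module LiftAlong (E : Net n) (U : VSet n) (Inv : Colouring {n} → Set)
    (lift : ∀ {φ α β W} → Proper φ → Inv φ → Valid E L U φ → KempeSet E U φ α β W → (∀ {v} → W ∋ v → sw α β (φ v) ∈ L v) →
            ∃ λ ψ → φ ≈ ψ × Inv ψ × ψ ≗[ U ] swapOn α β W φ) where

    -- `lift` realises a single Kempe change of U in G; Inv carries over what the next lift relies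
    -- on.
    lift-steps : ∀ {φ φ₀ χ₀} → Steps E L U φ₀ χ₀ → Proper φ → Inv φ → φ ≗[ U ] φ₀ →
      ∃ λ ψ → φ ≈ ψ × Inv ψ × ψ ≗[ U ] χ₀
    lift-steps {φ} ε V i eq = φ , ε , i , eq
    lift-steps {φ} {φ₀} (_◅_ {j = φ₁} m s) V i eq
      with lift V i (valid-cong before eq) (kempeSet-cong eq kempe)
             (λ {v} w → subst (_∈ L v) (trans (on w) (cong (sw α β) (sym (eq (inside kempe w))))) (listed after (inside kempe w)))
      where open Move m
    ... | ψ , t , i₁ , eq₁ with lift-steps s (steps-valid V t) i₁ eq₂
      where
      open Move m
      eq₂ : ψ ≗[ U ] φ₁
      eq₂ {u} pu with mem? W u
      ... | yes w = trans (eq₁ pu) (trans (swapOn-in α β W φ w) (trans (cong (sw α β) (eq pu)) (sym (on w))))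
      ... | no nw = trans (eq₁ pu) (trans (swapOn-out α β W φ nw) (trans (eq pu) (sym (off nw))))
    ... | ψ′ , t′ , i′ , eq′ = ψ′ , t ◅◅ t′ , i′ , eq′

    lift-to : ∀ {φ θ} → Good E L U → Proper φ → Inv φ → Valid E L U φ → Valid E L U θ →
      ∃ λ ψ → φ ≈ ψ × Inv ψ × ψ ≗[ U ] θ
    lift-to g V i vφ vθ with good-swappable g vφ vθ
    ... | χ , s , eq with lift-steps s V i (λ _ → refl)
    ... | ψ , t , i′ , eq′ = ψ , t , i′ , λ pu → trans (eq′ pu) (eq pu)

  sw-∈ : ∀ {v α β d} → α ∈ L v → β ∈ L v → d ∈ L v → sw α β d ∈ L v
  sw-∈ {v} {α} {β} {d} a b p with ab? α β d
  ... | yes (inj₁ refl) = subst (_∈ L v) (sym (sw-α α β)) b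
  ... | yes (inj₂ refl) = subst (_∈ L v) (sym (sw-β α β)) a
  ... | no nab = subst (_∈ L v) (sym (sw-other nab)) p

  ∈-both : ∀ {v c α β d} → c ∈ L v → AB α β c → sw α β c ∈ L v → AB α β d → d ∈ L v
  ∈-both {v} {α = α} {β} cL (inj₁ refl) sL (inj₁ refl) = cL
  ∈-both {v} {α = α} {β} cL (inj₁ refl) sL (inj₂ refl) = subst (_∈ L v) (sw-α α β) sL
  ∈-both {v} {α = α} {β} cL (inj₂ refl) sL (inj₁ refl) = subst (_∈ L v) (sw-β α β) sL
  ∈-both {v} {α = α} {β} cL (inj₂ refl) sL (inj₂ refl) = cL

  module _ {x y : Fin n} (x≢y : x ≢ y) (U : VSet n) where

    private
      E⁺ : Net n
      E⁺ = joined x y x≢y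

    deg-joined : ∀ p q → (p ≡ x × q ≡ y) ⊎ (p ≡ y × q ≡ x) → deg E⁺ U p ≤ suc (deg N (U - q) p)
    deg-joined p q pq = pigeonhole {ys = q ∷ members (Nb N (U - q) p)} (members-unique (Nb E⁺ U p)) λ {z} m → sub z (members-∈ (Nb E⁺ U p) m)
      where
      sub : ∀ z → Edge E⁺ p z × U ∋ z → z ∈ q ∷ members (Nb N (U - q) p)
      sub z (e , pz) with z Fin.≟ q
      sub z (e , pz) | yes r = here r
      sub z (inj₁ e , pz) | no ne = there (∈-members (Nb N (U - q) p) (e , pz , ne))
      sub z (inj₂ (inj₁ (r , s)) , pz) | no ne = ⊥-elim (case pq of
        λ { (inj₁ (_ , t)) → ne (trans s (sym t)) ; (inj₂ (a , _)) → x≢y (trans (sym r) a) })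
      sub z (inj₂ (inj₂ (r , s)) , pz) | no ne = ⊥-elim (case pq of
        λ { (inj₁ (a , _)) → x≢y (trans (sym a) r) ; (inj₂ (_ , t)) → ne (trans s (sym t)) })

    -- x and y each lose a neighbour, so joining them does not push their degree above k.
    tight-joined : (∃ λ z → x ∼ z × ¬ (U - y) ∋ z) → (∃ λ z → y ∼ z × ¬ (U - x) ∋ z) → Tight E⁺ L U
    tight-joined (z , e , nz) (z′ , e′ , nz′) = record { uniqᵗ = uniq ; tightᵗ = λ {v} pv → ≤-trans (bound v (v Fin.≟ x) (v Fin.≟ y)) (≤-reflexive (sym (len v))) }
      where
      bound : ∀ v → Dec (v ≡ x) → Dec (v ≡ y) → deg E⁺ U v ≤ k
      bound v (yes refl) _ = ≤-trans (deg-joined x y (inj₁ (refl , refl))) (deg-miss (U - y) e nz)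
      bound v (no _) (yes refl) = ≤-trans (deg-joined y x (inj₂ (refl , refl))) (deg-miss (U - x) e′ nz′)
      bound v (no a) (no b) = ≤-trans (size-mono (Nb E⁺ U v) (Nb N Whole v)
              λ { (inj₁ e , _) → e , tt ; (inj₂ (inj₁ (q , _)) , _) → ⊥-elim (a q) ; (inj₂ (inj₂ (q , _)) , _) → ⊥-elim (b q) })
              (≤-reflexive (reg v))

    -- Two neighbours lost against one edge gained. They are counted outside `U - q`, so q itself
    -- may be one of them if p and q are adjacent already.
    slack-joined : ∀ p q → (p ≡ x × q ≡ y) ⊎ (p ≡ y × q ≡ x) → U ∋ p →
      (∃₂ λ z z′ → p ∼ z × p ∼ z′ × z ≢ z′ × ¬ (U - q) ∋ z × ¬ (U - q) ∋ z′) → Slack E⁺ L U p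
    slack-joined p q pq pU (z , z′ , e , e′ , ne , nz , nz′) =
      pU , subst (deg E⁺ U p <_) (sym (len p)) (≤-trans (s≤s (deg-joined p q pq)) (deg-miss₂ (U - q) e nz e′ nz′ ne))

  module _ {x y : Fin n} {R : VSet n} (sp : Split x y R) where
    open Split sp

    U : VSet n
    U = ∁ R

    E⁺ : Net n
    E⁺ = joined x y x≢y

    Rim : Fin n → Set
    Rim u = R ∋ u ⊎ (u ≡ x ⊎ u ≡ y)

    Constant : Set
    Constant = ∀ {u w} → Rim u → Rim w → Sub u w

    rim-sym : ∀ {u w} → U ∋ u → R ∋ w → u ∼ w → u ≡ x ⊎ u ≡ y
    rim-sym nu w e = rim w (∼sym e) nu

    -- P is U, or U without u. If T missed a vertex of P, then T or the rest of P would avoid both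
    -- ends of the added edge. No edge leads from such a part into R, so u alone would cut it off in
    -- G.
    split-connected : ∀ P u {r} → (∀ {v} → P ∋ v → U ∋ v) → (∀ {v} → U ∋ v → v ≢ u → P ∋ v) →
      (¬ P ∋ u ⊎ u ≡ x) → P ∋ r → Conn E⁺ P r
    split-connected P u {r} sub sup hu pr T tr cl {w} pw with mem? T w
    ... | yes t = t
    ... | no nt = ⊥-elim (choose (x Fin.≟ u))
      where
      module _ (p q : Fin n) (p≢u : p ≢ u) (pU : U ∋ p) (epq : Edge E⁺ p q) (rename : ∀ {v} → v ≡ x ⊎ v ≡ y → v ≡ p ⊎ v ≡ q)
               (hs : ∀ {s} → P ∋ s → s ≢ q → s ≢ u) where
        pP : P ∋ p
        pP = sup pU p≢u
        -- Whichever side of T avoids p also avoids q, so it is closed in G - u.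
        escape : ∀ (S : VSet n) {s} → S ∋ s → (∀ {v} → S ∋ v → P ∋ v) → ¬ S ∋ p → ¬ S ∋ q →
          (∀ {v w} → S ∋ v → v ∼ w → P ∋ w → S ∋ w) → ⊥
        escape S {s} s∈ S⊆P np nq scl = np (2conn u S s∈ (hs (S⊆P s∈) (λ { refl → nq s∈ })) closed′ p≢u)
          where
          closed′ : ∀ {v w} → S ∋ v → v ≢ u → v ∼ w → w ≢ u → S ∋ w
          closed′ {v} {w} sv _ e w≢u with mem? R w
          ... | yes rw = ⊥-elim ([ (λ { refl → np sv }) , (λ { refl → nq sv }) ]′ (rename (rim-sym (sub (S⊆P sv)) rw e)))
          ... | no nrw = scl sv e (sup nrw w≢u)
        go : ⊥
        go with mem? T p
        ... | yes tp = escape (record { Mem = λ v → P ∋ v × ¬ T ∋ v ; mem? = λ v → mem? P v ×-dec ¬? (mem? T v) })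
                (pw , nt) proj₁ (λ (_ , a) → a tp) (λ (a , b) → b (cl tp pP epq a))
                λ (pv , ntv) e pw → pw , λ tw → ntv (cl tw pw (inj₁ (∼sym e)) pv)
        ... | no ntp = escape (record { Mem = λ v → P ∋ v × T ∋ v ; mem? = λ v → mem? P v ×-dec mem? T v })
                (pr , tr) proj₁ (λ (_ , a) → ntp a) (λ (a , b) → ntp (cl b a (esym E⁺ epq) pP))
                λ (pv , tv) e pw → pw , cl tv pv (inj₁ e) pw
      choose : Dec (x ≡ u) → ⊥
      choose (no x≢u) = go x y x≢u x∉R (inj₂ (inj₁ (refl , refl))) id
        λ s _ q → [ (λ nu → nu (subst (P ∋_) q s)) , (λ r → x≢u (sym r)) ]′ hu
      -- For u = x the end that is certain to remain is y, so x and y change roles.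
      choose (yes refl) = go y x (λ r → x≢y (sym r)) y∉R (inj₂ (inj₂ (refl , refl))) swap λ _ ne → ne

    good-split : ∀ {r} → Tight E⁺ L U → Slack E⁺ L U r → Good E⁺ L U
    good-split t s = mkGood t s (split-connected U x id (λ p _ → p) (inj₂ refl) (proj₁ s))

    fixed-split-exists : ∀ {u c r} → Tight E⁺ L U → U ∋ u → c ∈ L u →
      Slack E⁺ (del E⁺ L u c) (U - u) r → ∃ λ θ → Valid E⁺ L U θ × θ u ≡ c
    fixed-split-exists {u} t pu cL s =
      fixed-exists {P = U} (mkGood (tight-fix pu t) s (split-connected (U - u) u proj₁ (λ a b → a , b) (inj₁ (λ q → proj₂ q refl)) (proj₁ s))) cL

    valid-split : ∀ {φ} → Proper φ → φ x ≢ φ y → Valid E⁺ L U φ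
    valid-split {φ} V ne = valid pr (λ _ → listed V tt)
      where
      pr : ∀ {u w} → U ∋ u → U ∋ w → Edge E⁺ u w → φ u ≢ φ w
      pr _ _ (inj₁ e) = proper V tt tt e
      pr _ _ (inj₂ (inj₁ (refl , refl))) = ne
      pr _ _ (inj₂ (inj₂ (refl , refl))) = λ q → ne (sym q)

    -- A Kempe change of U extends to R by swapping α and β on all of R or on none of it.
    lift-kempe : ∀ {E φ α β W} {Trig : Set} → (∀ {u w} → u ∼ w → Edge E u w) → Dec Trig → Proper φ → KempeSet E U φ α β W →
      (∀ {v} → W ∋ v → sw α β (φ v) ∈ L v) →
      (∀ {u r} → U ∋ u → R ∋ r → u ∼ r → AB α β (φ u) → AB α β (φ r) → (W ∋ u → Trig) × (Trig → W ∋ u)) →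
      (∀ {r} → Trig → R ∋ r → AB α β (φ r) → sw α β (φ r) ∈ L r) →
      ∃ λ ψ → φ ≈ ψ × ψ ≗[ U ] swapOn α β W φ × (∀ {r} → R ∋ r → Trig → ψ r ≡ sw α β (φ r)) × (∀ {r} → R ∋ r → ¬ Trig → ψ r ≡ φ r)
    lift-kempe {E} {φ} {α} {β} {W} {Trig} emb trig? V kW inL across inR =
      swapOn α β W′ φ , swapOn-move V k′ lst ◅ ε , onU , onR , offR
      where
      W′ : VSet n
      W′ = record { Mem = λ v → W ∋ v ⊎ (R ∋ v × Trig × AB α β (φ v))
                  ; mem? = λ v → mem? W v ⊎-dec (mem? R v ×-dec (trig? ×-dec ab? α β (φ v))) }
      lst : ∀ {v} → W′ ∋ v → sw α β (φ v) ∈ L v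
      lst (inj₁ w) = inL w
      lst (inj₂ (r , t , ab)) = inR t r ab
      k′ : KempeSet N Whole φ α β W′
      k′ .inside _ = tt
      k′ .bicol (inj₁ w) = bicol kW w
      k′ .bicol (inj₂ (_ , _ , ab)) = ab
      k′ .closed {u} {w} m e _ ab with mem? R w
      k′ .closed (inj₁ wu) e _ ab | yes rw = inj₂ (rw , proj₁ (across (inside kW wu) rw e (bicol kW wu) ab) wu , ab)
      k′ .closed (inj₂ (ru , t , _)) e _ ab | yes rw = inj₂ (rw , t , ab)
      k′ .closed (inj₁ wu) e _ ab | no nrw = inj₁ (closed kW wu (emb e) nrw ab)
      k′ .closed (inj₂ (ru , t , abu)) e _ ab | no nrw = inj₁ (proj₂ (across nrw ru (∼sym e) ab abu) t)
      onU : swapOn α β W′ φ ≗[ U ] swapOn α β W φ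
      onU pu = swapOn-same α β W′ W φ [ id , (λ (r , _) → ⊥-elim (pu r)) ]′ inj₁
      onR : ∀ {r} → R ∋ r → Trig → swapOn α β W′ φ r ≡ sw α β (φ r)
      onR {r} pr t = case ab? α β (φ r) of λ { (yes ab) → swapped ab ; (no nab) → fixed nab }
        where
        swapped : AB α β (φ r) → swapOn α β W′ φ r ≡ sw α β (φ r)
        swapped ab = swapOn-in α β W′ φ (inj₂ (pr , t , ab))
        fixed : ¬ AB α β (φ r) → swapOn α β W′ φ r ≡ sw α β (φ r)
        fixed nab = trans (swapOn-out α β W′ φ [ nab ∘ bicol kW , (λ (_ , _ , ab) → nab ab) ]′) (sym (sw-other nab))
      offR : ∀ {r} → R ∋ r → ¬ Trig → swapOn α β W′ φ r ≡ φ r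
      offR pr nt = swapOn-out α β W′ φ [ (λ w → inside kW w pr) , (λ (_ , t , _) → nt t) ]′

    -- K collects the vertices of R that must stay different from y while U is recoloured; in the
    -- applications it is empty or a single neighbour of x.
    Separated : (Fin n → Set) → Colouring {n} → Set
    Separated K φ = φ x ≢ φ y × (∀ {r} → K r → R ∋ r × φ r ≢ φ y)

    -- R is exchanged exactly when W contains x or y. Since x and y are joined, the other one is
    -- then in W too or has neither colour. So R undergoes the same permutation of colours as x and
    -- y, and inequalities with the colour of y survive.
    lift-separated : Constant → ∀ K {φ θ} → Good E⁺ L U → Proper φ → Separated K φ → Valid E⁺ L U θ →
      ∃ λ ψ → φ ≈ ψ × Separated K ψ × ψ ≗[ U ] θ
    lift-separated const K g V s vθ = LiftAlong.lift-to E⁺ U (Separated K) one g V s (valid-split V (proj₁ s)) vθ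
      where
      one : ∀ {φ α β W} → Proper φ → Separated K φ → Valid E⁺ L U φ → KempeSet E⁺ U φ α β W → (∀ {v} → W ∋ v → sw α β (φ v) ∈ L v) →
            ∃ λ ψ → φ ≈ ψ × Separated K ψ × ψ ≗[ U ] swapOn α β W φ
      one {φ} {α} {β} {W} V (ne , sepK) vU kW inL
        with lift-kempe {Trig = W ∋ x ⊎ W ∋ y} inj₁ (mem? W x ⊎-dec mem? W y) V kW inL across inR
        where
        x→y : AB α β (φ y) → W ∋ x → W ∋ y
        x→y ab w = closed kW w (inj₂ (inj₁ (refl , refl))) y∉R ab
        y→x : AB α β (φ x) → W ∋ y → W ∋ x
        y→x ab w = closed kW w (inj₂ (inj₂ (refl , refl))) x∉R ab
        across : ∀ {u r} → U ∋ u → R ∋ r → u ∼ r → AB α β (φ u) → AB α β (φ r) → (W ∋ u → W ∋ x ⊎ W ∋ y) × (W ∋ x ⊎ W ∋ y → W ∋ u)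
        across pu rr e ab _ = case rim-sym pu rr e of
          λ { (inj₁ refl) → inj₁ , [ id , y→x ab ]′ ; (inj₂ refl) → inj₂ , [ x→y ab , id ]′ }
        inR : ∀ {r} → W ∋ x ⊎ W ∋ y → R ∋ r → AB α β (φ r) → sw α β (φ r) ∈ L r
        inR {r} (inj₁ w) rr ab = const (inj₂ (inj₁ refl)) (inj₁ rr) _ (∈-both (listed V tt) (bicol kW w) (inL w) (sw-AB ab))
        inR {r} (inj₂ w) rr ab = const (inj₂ (inj₂ refl)) (inj₁ rr) _ (∈-both (listed V tt) (bicol kW w) (inL w) (sw-AB ab))
      ... | ψ , t , onU , onR , offR = ψ , t , (ne′ , λ {r} kr → proj₁ (sepK kr) , sep (proj₁ (sepK kr)) (proj₂ (sepK kr))) , onU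
        where
        vψ : Valid E⁺ L U ψ
        vψ = valid-cong (Move.after (swapOn-move vU kW inL)) onU
        ne′ : ψ x ≢ ψ y
        ne′ = proper vψ x∉R y∉R (inj₂ (inj₁ (refl , refl)))
        sep : ∀ {r} → R ∋ r → φ r ≢ φ y → ψ r ≢ ψ y
        sep {r} rr nq q with mem? W y | mem? W x
        ... | yes wy | _ = nq (sw-injective α β (trans (sym (onR rr (inj₂ wy))) (trans q (trans (onU y∉R) (swapOn-in α β W φ wy)))))
        -- As x is in W and y is not, the edge between them keeps φ y off α and β, so the exchange
        -- fixes it.
        ... | no nwy | yes wx = nq (sw-injective α β (trans (sym (onR rr (inj₁ wx))) (trans q (trans (onU y∉R)
                (trans (swapOn-out α β W φ nwy) (sym (sw-other (λ ab → nwy (closed kW wx (inj₂ (inj₁ (refl , refl))) y∉R ab)))))))))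
        ... | no nwy | no nwx = nq (trans (sym (offR rr [ nwx , nwy ]′)) (trans q (trans (onU y∉R) (swapOn-out α β W φ nwy))))

    -- Renaming colours on R so that two colourings agree on x and y.
    glue : Constant → ∀ {χ θ : Colouring {n}} → (∀ {u w} → Rim u → Rim w → u ∼ w → χ u ≢ χ w) → (∀ {u} → Rim u → χ u ∈ L u) → χ x ≢ χ y →
      Valid E⁺ L U θ → ∃ λ φ → Proper φ × φ x ≢ φ y
    glue const {χ} {θ} χ-proper χ-listed χ≢ vθ = φ , valid pr li , λ q → θ≢ (trans (sym (φ-U x∉R)) (trans q (φ-U y∉R)))
      where
      θ≢ : θ x ≢ θ y
      θ≢ = proper vθ x∉R y∉R (inj₂ (inj₁ (refl , refl)))
      σ ρ : ℕ → ℕ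
      σ = sw (χ x) (θ x)
      -- σ takes χ x to θ x. The outer exchange takes the image of χ y to θ y and leaves θ x fixed,
      -- because χ and θ both distinguish x from y.
      ρ c = sw (σ (χ y)) (θ y) (σ c)
      ρ-injective : ∀ {c d} → ρ c ≡ ρ d → c ≡ d
      ρ-injective = sw-injective (χ x) (θ x) ∘ sw-injective (σ (χ y)) (θ y)
      σx : σ (χ x) ≡ θ x
      σx = sw-α (χ x) (θ x)
      ρx : ρ (χ x) ≡ θ x
      ρx = trans (cong (sw (σ (χ y)) (θ y)) σx)
             (sw-other [ (λ q → χ≢ (sw-injective (χ x) (θ x) (trans σx q))) , θ≢ ]′)
      ρy : ρ (χ y) ≡ θ y
      ρy = sw-α (σ (χ y)) (θ y)
      φ : Colouring {n}
      φ v = if ⌊ mem? R v ⌋ then ρ (χ v) else θ v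
      φ-R : ∀ {v} → R ∋ v → φ v ≡ ρ (χ v)
      φ-R {v} rv with mem? R v
      ... | yes _ = refl
      ... | no n = ⊥-elim (n rv)
      φ-U : ∀ {v} → U ∋ v → φ v ≡ θ v
      φ-U {v} nv with mem? R v
      ... | yes r = ⊥-elim (nv r)
      ... | no _ = refl
      φ-rim : ∀ {v} → Rim v → φ v ≡ ρ (χ v)
      φ-rim (inj₁ r) = φ-R r
      φ-rim (inj₂ (inj₁ refl)) = trans (φ-U x∉R) (sym ρx)
      φ-rim (inj₂ (inj₂ refl)) = trans (φ-U y∉R) (sym ρy)
      near : ∀ {u w} → R ∋ u → u ∼ w → Rim w
      near {w = w} ru e with mem? R w
      ... | yes r = inj₁ r
      ... | no nr = inj₂ (rim ru e nr)
      both : ∀ {u w} → Rim u → Rim w → u ∼ w → φ u ≢ φ w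
      both ru rw e q = χ-proper ru rw e (ρ-injective (trans (sym (φ-rim ru)) (trans q (φ-rim rw))))
      pr : ∀ {u w} → ⊤ → ⊤ → u ∼ w → φ u ≢ φ w
      pr {u} {w} _ _ e = case mem? R u of λ
        { (yes ru) → both (inj₁ ru) (near ru e) e
        ; (no nu) → case mem? R w of λ
          { (yes rw) → both (near rw (∼sym e)) (inj₁ rw) e
          ; (no nw) q → proper vθ nu nw (inj₁ e) (trans (sym (φ-U nu)) (trans q (φ-U nw))) } }
      ρ-closed : ∀ {v c} → R ∋ v → c ∈ L v → ρ c ∈ L v
      ρ-closed rv cL = sw-∈ (sw-∈ χx∈ θx∈ χy∈) (from (inj₂ refl) (listed vθ y∉R)) (sw-∈ χx∈ θx∈ cL)
        where
        from : ∀ {u d} → u ≡ x ⊎ u ≡ y → d ∈ L u → d ∈ L _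
        from r = const (inj₂ r) (inj₁ rv) _
        χx∈ = from (inj₁ refl) (χ-listed (inj₂ (inj₁ refl)))
        χy∈ = from (inj₂ refl) (χ-listed (inj₂ (inj₂ refl)))
        θx∈ = from (inj₁ refl) (listed vθ x∉R)
      li : ∀ {u} → ⊤ → φ u ∈ L u
      li {u} _ with mem? R u
      ... | yes ru = ρ-closed ru (χ-listed (inj₁ ru))
      ... | no nu = listed vθ nu

  -- Constant lists on one side of the cut

  module Cases (k≥3 : 3 ≤ k) {A : VSet n} {x₀ y₀ : Fin n} (sf₀ : SmallestFragment G A x₀ y₀) where
    open Cut G 2conn (λ v → subst (3 ≤_) (sym (reg v)) k≥3)

    ConstantOn : VSet n → Set
    ConstantOn R = ∀ {r w} → R ∋ r → r ∼ w → Sub r w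

    constant-or-loose : ∀ R → ConstantOn R ⊎ (∃₂ λ r c → R ∋ r × Loose r c)
    constant-or-loose R with Fin.any? (λ r → Fin.any? λ w → mem? R r ×-dec ((adj r w Bool.≟ true) ×-dec ¬? (sub? r w)))
    ... | no none = inj₁ λ {r} {w} rr e → case sub? r w of λ { (yes s) → s ; (no ns) → ⊥-elim (none (r , w , rr , e , ns)) }
    ... | yes (r , w , rr , e , ns) = inj₂ (case sub-or-not r w of
            λ { (inj₁ s) → ⊥-elim (ns s) ; (inj₂ (c , p , q)) → r , c , rr , p , w , e , q })

    -- R may have several components; those whose list differs from that of x would be cut off from
    -- x by y alone. The vertex z transfers the list to y.
    constant-rim : ∀ {x y R} (sp : Split x y R) → ConstantOn R → (∃ λ z → R ∋ z × y ∼ z) → Constant sp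
    constant-rim {x} {y} {R} sp con (z , rz , e) {u} {w} ru rw c p = sub-sym (to-x rw) c (to-x ru c p)
      where
      open Split sp
      bad : VSet n
      bad = record { Mem = λ v → R ∋ v × ¬ Sub v x ; mem? = λ v → mem? R v ×-dec ¬? (sub? v x) }
      closed′ : ∀ {p q} → bad ∋ p → p ≢ y → p ∼ q → q ≢ y → bad ∋ q
      closed′ {p} {q} (rp , np) _ e q≢ with mem? R q
      ... | yes rq = rq , λ s → np λ c m → s c (con rp e c m)
      ... | no nrq with rim rp e nrq
      ...   | inj₁ refl = ⊥-elim (np (con rp e))
      ...   | inj₂ r = ⊥-elim (q≢ r)
      inside-x : ∀ {v} → R ∋ v → Sub v x
      inside-x {v} rv with sub? v x
      ... | yes s = s
      ... | no ns = ⊥-elim (x∉R (proj₁ (2conn y bad (rv , ns) (λ { refl → y∉R rv }) closed′ x≢y)))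
      to-x : ∀ {u} → Rim sp u → Sub u x
      to-x (inj₁ r) = inside-x r
      to-x (inj₂ (inj₁ refl)) c m = m
      to-x (inj₂ (inj₂ refl)) c m = inside-x rz c (sub-sym (con rz (∼sym e)) c m)

    -- A loose vertex and its witness both lie outside R. The pair is therefore realised on U with x
    -- and y joined, the witness being slack, and lifting from φ₀ reaches it.
    separated-classes : ∀ {x y R r φ₀} (sp : Split x y R) → Constant sp → ConstantOn R → Tight (E⁺ sp) L (U sp) →
      Slack (E⁺ sp) L (U sp) r → Proper φ₀ → φ₀ x ≢ φ₀ y → Classes φ₀
    separated-classes {x} {y} {R} {r} {φ₀} sp const con t s V₀ ne = reached-classes V₀ reach-class
      where
      reach-class : ∀ {v c} → Loose v c → ∃ λ ψ → φ₀ ≈ ψ × ψ v ≡ c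
      reach-class {v} {c} (cL , w , e , c∉) with mem? R v | mem? R w
      ... | yes rv | _ = ⊥-elim (c∉ (con rv e c cL))
      ... | no _ | yes rw = ⊥-elim (c∉ (sub-sym (con rw (∼sym e)) c cL))
      ... | no nv | no nw
        with fixed-split-exists sp t nv cL (slack-new nv t nw (inj₁ e) c∉)
      ... | θ , vθ , q with lift-separated sp const (λ _ → ⊥) (good-split sp t s) V₀ (ne , λ ()) vθ
      ... | ψ , st , _ , eq = ψ , st , trans (eq nv) q

    -- Each side with x and y joined has a colouring. The edge makes x and y differ in both, which
    -- is what `glue` needs to fit them together.
    two-coloured : ∀ {x y R R′} (sp : Split x y R) (sp′ : Split x y R′) → Constant sp →
      (∀ {u} → Rim sp u → U sp′ ∋ u) → Good (E⁺ sp) L (U sp) → Good (E⁺ sp′) L (U sp′) → ∃ λ φ → Proper φ × φ x ≢ φ y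
    two-coloured {x} {y} sp sp′ const sub g g′ with good-colorable g | good-colorable g′
    ... | θ , vθ | χ , vχ = glue sp const (λ ru rw e → proper vχ (sub ru) (sub rw) (inj₁ e)) (λ r → listed vχ (sub r))
            (proper vχ (sub (inj₂ (inj₁ refl))) (sub (inj₂ (inj₂ refl))) (inj₂ (inj₁ (refl , refl)))) vθ

    module Sides {x y : Fin n} (sf : SmallestFragment G A x y) where
      open Smallest sf public

      B : VSet n
      B = opposite A x y

      fragB : Fragment G B x y
      fragB = fragment-opposite {A} frag

      ∈B : ∀ {u} → ¬ A ∋ u → u ≢ x → u ≢ y → B ∋ u
      ∈B a b c = (a , b) , c

      B∌ : ∀ {u} → ¬ B ∋ u → A ∋ u ⊎ u ≡ x ⊎ u ≡ y
      B∌ {u} nb with mem? A u | u Fin.≟ x | u Fin.≟ y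
      ... | yes a | _ | _ = inj₁ a
      ... | no _ | yes q | _ = inj₂ (inj₁ q)
      ... | no _ | no _ | yes q = inj₂ (inj₂ q)
      ... | no a | no p | no q = ⊥-elim (nb (∈B a p q))

      splitA : Split x y A
      splitA = record { x≢y = x≢y ; x∉R = x∉A ; y∉R = y∉A ; rim = boundary }

      splitB : Split x y B
      splitB = record { x≢y = x≢y ; x∉R = proj₁ (proj₂ fragB) ; y∉R = proj₁ (proj₂ (proj₂ fragB))
                      ; rim = proj₂ (proj₂ (proj₂ (proj₂ (proj₂ fragB)))) _ _ }

      y-in-A : ∃ λ z → A ∋ z × y ∼ z
      y-in-A = neighbour-inside {A} (fragment-swap G {A} frag)

      y-in-B : ∃ λ z → B ∋ z × y ∼ z
      y-in-B = neighbour-inside {B} (fragment-swap G {B} fragB)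

      constA : ConstantOn A → Constant splitA
      constA con = constant-rim splitA con y-in-A

      constB : ConstantOn B → Constant splitB
      constB con = constant-rim splitB con y-in-B

      tightA : Tight (E⁺ splitA) L (U splitA)
      tightA with neighbour-inside {A} frag | y-in-A
      ... | z , az , e | z′ , az′ , e′ = tight-joined x≢y (∁ A) (z , e , λ (p , _) → p az) (z′ , e′ , λ (p , _) → p az′)

      slackA : Slack (E⁺ splitA) L (U splitA) x
      slackA with two-neighbours x
      ... | z , az , e , _ with two-neighbours z
      ...   | z′ , az′ , e′ , ne = slack-joined x≢y (∁ A) x y (inj₁ (refl , refl)) x∉A
                (z , z′ , e , e′ , ≢-sym ne , (λ (p , _) → p az) , λ (p , _) → p az′)

      goodA : Good (E⁺ splitA) L (U splitA)
      goodA = good-split splitA tightA slackA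

      rimA⊆ : ∀ {u} → Rim splitA u → U splitB ∋ u
      rimA⊆ (inj₁ a) ((na , _) , _) = na a
      rimA⊆ (inj₂ (inj₁ refl)) = Split.x∉R splitB
      rimA⊆ (inj₂ (inj₂ refl)) = Split.y∉R splitB

      rimB⊆ : ∀ {u} → Rim splitB u → U splitA ∋ u
      rimB⊆ (inj₁ ((na , _) , _)) = na
      rimB⊆ (inj₂ (inj₁ refl)) = x∉A
      rimB⊆ (inj₂ (inj₂ refl)) = y∉A

      b : Fin n
      b = proj₁ (neighbour-outside {A} frag)
      b∉A : ¬ A ∋ b
      b∉A = proj₁ (proj₁ (proj₂ (neighbour-outside {A} frag)))
      b≢y : b ≢ y
      b≢y = proj₂ (proj₁ (proj₂ (neighbour-outside {A} frag)))
      x∼b : x ∼ b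
      x∼b = proj₂ (proj₂ (neighbour-outside {A} frag))
      b≢x : b ≢ x
      b≢x q = eirr N (subst (x ∼_) q x∼b)
      b∈B : B ∋ b
      b∈B = ∈B b∉A b≢x b≢y

      -- As b differs from y, this also says that x and y are not adjacent.
      Alone : Set
      Alone = ∀ {w} → x ∼ w → ¬ A ∋ w → w ≡ b

      second-or-alone : (∃ λ b′ → x ∼ b′ × ¬ A ∋ b′ × b′ ≢ b) ⊎ Alone
      second-or-alone with Fin.any? (λ w → (adj x w Bool.≟ true) ×-dec (¬? (mem? A w) ×-dec ¬? (w Fin.≟ b)))
      ... | yes r = inj₁ r
      ... | no none = inj₂ λ {w} e nw → case w Fin.≟ b of λ { (yes q) → q ; (no ne) → ⊥-elim (none (w , e , nw , ne)) }

      tightB : Tight (E⁺ splitB) L (U splitB)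
      tightB = tight-joined x≢y (∁ B) (b , x∼b , λ (p , _) → p b∈B)
        (proj₁ y-in-B , proj₂ (proj₂ y-in-B) , λ (p , _) → p (proj₁ (proj₂ y-in-B)))

      slackB : (∃ λ b′ → x ∼ b′ × ¬ A ∋ b′ × b′ ≢ b) → Slack (E⁺ splitB) L (U splitB) x
      slackB (b′ , e , nb′ , ne) = slack-joined x≢y (∁ B) x y (inj₁ (refl , refl)) (Split.x∉R splitB)
        (b , b′ , x∼b , e , ≢-sym ne , (λ (p , _) → p b∈B) , λ (p , q) → p (∈B nb′ (λ { refl → eirr N e }) q))

      -- When b is the only neighbour of x outside A, the pair b , y separates A ∪ {x} from B - b.
      module Slide (alone : Alone) where

        A⁺ B⁻ : VSet n
        A⁺ = A ∪₁ x
        B⁻ = B - b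

        b∉A⁺ : ¬ A⁺ ∋ b
        b∉A⁺ = [ b∉A , b≢x ]′
        y∉A⁺ : ¬ A⁺ ∋ y
        y∉A⁺ = [ y∉A , (λ q → x≢y (sym q)) ]′

        splitA⁺ : Split b y A⁺
        splitA⁺ = record { x≢y = b≢y ; x∉R = b∉A⁺ ; y∉R = y∉A⁺ ; rim = rim′ }
          where
          rim′ : ∀ {u w} → A⁺ ∋ u → u ∼ w → ¬ A⁺ ∋ w → w ≡ b ⊎ w ≡ y
          rim′ (inj₁ au) e nw = case boundary au e (nw ∘ inj₁) of λ { (inj₁ q) → ⊥-elim (nw (inj₂ q)) ; (inj₂ q) → inj₂ q }
          rim′ (inj₂ refl) e nw = inj₁ (alone e (nw ∘ inj₁))

        splitB⁻ : Split b y B⁻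
        splitB⁻ = record { x≢y = b≢y ; x∉R = λ (_ , q) → q refl ; y∉R = Split.y∉R splitB ∘ proj₁ ; rim = rim′ }
          where
          rim′ : ∀ {u w} → B⁻ ∋ u → u ∼ w → ¬ B⁻ ∋ w → w ≡ b ⊎ w ≡ y
          rim′ {u} {w} (bu@((nu , _) , _) , ne) e nw with w Fin.≟ b | mem? B w
          ... | yes q | _ = inj₁ q
          ... | no q | yes bw = ⊥-elim (nw (bw , q))
          ... | no _ | no nbw with Split.rim splitB bu e nbw
          ...   | inj₁ refl = ⊥-elim (ne (alone (∼sym e) nu))
          ...   | inj₂ q = inj₂ q

        rimB⁻⊆ : ∀ {u} → Rim splitB⁻ u → U splitA⁺ ∋ u
        rimB⁻⊆ (inj₁ (((na , nx) , _) , _)) = [ na , nx ]′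
        rimB⁻⊆ (inj₂ (inj₁ refl)) = b∉A⁺
        rimB⁻⊆ (inj₂ (inj₂ refl)) = y∉A⁺

        tightA⁺ : Tight (E⁺ splitA⁺) L (U splitA⁺)
        tightA⁺ = tight-joined b≢y (∁ A⁺) (x , ∼sym x∼b , λ (p , _) → p (inj₂ refl))
          (proj₁ y-in-A , proj₂ (proj₂ y-in-A) , λ (p , _) → p (inj₁ (proj₁ (proj₂ y-in-A))))

        -- The spare colour sits at y: on the side of A⁺ the vertex b has the single neighbour x,
        -- whereas y has two neighbours in A by minimality.
        slackA⁺ : Slack (E⁺ splitA⁺) L (U splitA⁺) y
        slackA⁺ with Smallest.two-neighbours (smallest-swap sf) x
        ... | z , az , e , _ with Smallest.two-neighbours (smallest-swap sf) z
        ...   | z′ , az′ , e′ , ne = slack-joined b≢y (∁ A⁺) y b (inj₂ (refl , refl)) y∉A⁺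
                  (z , z′ , e , e′ , ≢-sym ne , (λ (p , _) → p (inj₁ az)) , λ (p , _) → p (inj₁ az′))

        goodA⁺ : Good (E⁺ splitA⁺) L (U splitA⁺)
        goodA⁺ = good-split splitA⁺ tightA⁺ slackA⁺

        b-outside : ∀ {z} → b ∼ z → z ≢ x → ¬ (U splitB⁻ - y) ∋ z
        b-outside {z} e zx (p , zy) = p ((∈B nz zx zy) , λ { refl → eirr N e })
          where
          nz : ¬ A ∋ z
          nz az = [ b≢x , b≢y ]′ (boundary az (∼sym e) b∉A)

        -- b has two neighbours besides x, and none of them is in A. One may be y; it counts as
        -- well, since the joining edge is then nothing new.
        slackB⁻ : Slack (E⁺ splitB⁻) L (U splitB⁻) b
        slackB⁻ with third-neighbour b x y
        ... | z , e , zx , _ with third-neighbour b x z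
        ...   | z′ , e′ , zx′ , ne = slack-joined b≢y (∁ B⁻) b y (inj₁ (refl , refl)) (Split.x∉R splitB⁻)
                  (z , z′ , e , e′ , ≢-sym ne , b-outside e zx , b-outside e′ zx′)

        tightB⁻ : Tight (E⁺ splitB⁻) L (U splitB⁻)
        tightB⁻ with third-neighbour b x y | y-in-B
        ... | z , e , zx , _ | z′ , bz′ , e′ = tight-joined b≢y (∁ B⁻) (z , e , b-outside e zx) (z′ , e′ , λ (p , q) → p (bz′ , q))

        goodB⁻ : Good (E⁺ splitB⁻) L (U splitB⁻)
        goodB⁻ = good-split splitB⁻ tightB⁻ slackB⁻

        constB⁻ : ConstantOn B → Constant splitB⁻
        constB⁻ con ru rw = constB con (toB ru) (toB rw)
          where
          toB : ∀ {u} → Rim splitB⁻ u → Rim splitB u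
          toB (inj₁ (r , _)) = inj₁ r
          toB (inj₂ (inj₁ refl)) = inj₁ b∈B
          toB (inj₂ (inj₂ q)) = inj₂ (inj₂ q)

        -- The lists need not be constant on A ∪ {x , b , y}; instead φ x ≡ φ y keeps b and y in step.
        lift-equal : ConstantOn A → ∀ {φ θ} → Proper φ → φ x ≡ φ y → Valid (E⁺ splitA⁺) L (U splitA⁺) θ →
          ∃ λ ψ → φ ≈ ψ × ψ x ≡ ψ y × ψ ≗[ U splitA⁺ ] θ
        lift-equal con {φ} V eq vθ = LiftAlong.lift-to (E⁺ splitA⁺) (U splitA⁺) (λ φ → φ x ≡ φ y) one goodA⁺ V eq
          (valid-split splitA⁺ V (λ q → proper V tt tt x∼b (trans eq (sym q)))) vθ
          where
          one : ∀ {φ α β W} → Proper φ → φ x ≡ φ y → Valid (E⁺ splitA⁺) L (U splitA⁺) φ → KempeSet (E⁺ splitA⁺) (U splitA⁺) φ α β W →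
            (∀ {v} → W ∋ v → sw α β (φ v) ∈ L v) → ∃ λ ψ → φ ≈ ψ × ψ x ≡ ψ y × ψ ≗[ U splitA⁺ ] swapOn α β W φ
          one {φ} {α} {β} {W} V eq _ kW inL
            with lift-kempe splitA⁺ {Trig = W ∋ y} inj₁ (mem? W y) V kW inL across inR
            where
            across : ∀ {u r} → U splitA⁺ ∋ u → A⁺ ∋ r → u ∼ r → AB α β (φ u) → AB α β (φ r) → (W ∋ u → W ∋ y) × (W ∋ y → W ∋ u)
            -- In A⁺ only x is adjacent to b. Since x has the colour of y, an α,β-coloured x means
            -- an α,β-coloured y, and the edge between b and y puts both or neither into W.
            across {u} {r} pu rr e abu abr = case rim-sym splitA⁺ pu rr e of λ
              { (inj₂ refl) → id , id
              ; (inj₁ refl) → (λ w → closed kW w (inj₂ (inj₁ (refl , refl))) y∉A⁺ (subst (AB α β) (trans (cong φ (r≡x rr e)) eq) abr))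
                            , (λ w → closed kW w (inj₂ (inj₂ (refl , refl))) b∉A⁺ abu) }
              where
              r≡x : ∀ {r} → A⁺ ∋ r → b ∼ r → r ≡ x
              r≡x (inj₁ ar) e = ⊥-elim ([ b≢x , b≢y ]′ (boundary ar (∼sym e) b∉A))
              r≡x (inj₂ q) e = q
            inR : ∀ {r} → W ∋ y → A⁺ ∋ r → AB α β (φ r) → sw α β (φ r) ∈ L r
            inR {r} w rr ab = constA con {y} {r} (inj₂ (inj₂ refl)) (case rr of λ { (inj₁ a) → inj₁ a ; (inj₂ q) → inj₂ (inj₁ q) }) _
              (∈-both (listed V tt) (bicol kW w) (inL w) (sw-AB ab))
          ... | ψ , t , onU , onR , offR = ψ , t , step-eq , onU
            where
            step-eq : ψ x ≡ ψ y
            step-eq with mem? W y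
            ... | yes w = trans (onR (inj₂ refl) w) (trans (cong (sw α β) eq) (sym (trans (onU y∉A⁺) (swapOn-in α β W φ w))))
            ... | no nw = trans (offR (inj₂ refl) nw) (trans eq (sym (trans (onU y∉A⁺) (swapOn-out α β W φ nw))))

        equal-classes : ConstantOn A → ∀ {φ₀} → Proper φ₀ → φ₀ x ≡ φ₀ y → Classes φ₀
        equal-classes con {φ₀} V₀ eq = reached-classes V₀ reach-class
          where
          lifted : ∀ {u c} → U splitA⁺ ∋ u → (∃ λ θ → Valid (E⁺ splitA⁺) L (U splitA⁺) θ × θ u ≡ c) →
            ∃ λ ψ → φ₀ ≈ ψ × ψ x ≡ ψ y × ψ u ≡ c
          lifted pu (θ , vθ , q) = case lift-equal con V₀ eq vθ of λ
            (ψ , st , e′ , agree) → ψ , st , e′ , trans (agree pu) q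
          y-class : ∀ {c} w → U splitA⁺ ∋ w → Edge (E⁺ splitA⁺) y w → c ∈ L y → c ∉ L w → ∃ λ ψ → φ₀ ≈ ψ × ψ x ≡ ψ y × ψ y ≡ c
          y-class w nw e cL c∉ = lifted y∉A⁺ (fixed-split-exists splitA⁺ tightA⁺ y∉A⁺ cL (slack-new y∉A⁺ tightA⁺ nw e c∉))
          away : ∀ {v w c} → v ∼ w → c ∈ L v → c ∉ L w → ¬ A ∋ w
          away e cL c∉ aw = c∉ (sub-sym (con aw (∼sym e)) _ cL)
          x→y : Sub x y
          x→y = constA con (inj₂ (inj₁ refl)) (inj₂ (inj₂ refl))
          other : ∀ {v c} → ¬ A ∋ v → v ≢ x → v ≢ y → c ∈ L v → ∃ λ ψ → φ₀ ≈ ψ × ψ x ≡ ψ y × ψ v ≡ c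
          other nv vx vy cL = lifted [ nv , vx ]′ (fixed-split-exists splitA⁺ tightA⁺ [ nv , vx ]′ cL
            (slack-keep {E = E⁺ splitA⁺} {L} {U splitA⁺} [ nv , vx ]′ (≢-sym vy) (uniq y) slackA⁺))
          reach-class : ∀ {v c} → Loose v c → ∃ λ ψ → φ₀ ≈ ψ × ψ v ≡ c
          reach-class {v} {c} (cL , w , e , c∉) = choose (mem? A v) (v Fin.≟ x) (v Fin.≟ y)
            where
            choose : Dec (A ∋ v) → Dec (v ≡ x) → Dec (v ≡ y) → ∃ λ ψ → φ₀ ≈ ψ × ψ v ≡ c
            choose (yes av) _ _ = ⊥-elim (c∉ (con av e c cL))
            -- x is not in the recoloured part, so y receives c and `ψ x ≡ ψ y` passes it on to x.
            -- The slack vertex is b: it is joined to y, and it is the only possible witness, so its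
            -- list lacks c.
            choose (no _) (yes refl) _ =
              case y-class b b∉A⁺ (inj₂ (inj₂ (refl , refl))) (x→y c cL) (subst (λ z → c ∉ L z) (alone e (away e cL c∉)) c∉) of
                λ (ψ , st , p , q) → ψ , st , trans p q
            choose (no _) (no _) (yes refl) =
              case y-class w [ away e cL c∉ , (λ { refl → c∉ (sub-sym x→y c cL) }) ]′ (inj₁ e) cL c∉ of λ (ψ , st , _ , q) → ψ , st , q
            choose (no nv) (no vx) (no vy) = case other nv vx vy cL of λ (ψ , st , _ , q) → ψ , st , q

      -- If x has only b outside A, a colouring that distinguishes x from y is not guaranteed. An
      -- arbitrary colouring is taken, and whichever pattern it shows on x and y is preserved.
      constantA-classes : ConstantOn A → ∀ {v c} → Loose v c → ∃ λ φ₀ → Proper φ₀ × Classes φ₀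
      constantA-classes con l = case second-or-alone of λ
        { (inj₁ b′) → from (two-coloured splitA splitB (constA con) rimA⊆ goodA (good-split splitB tightB (slackB b′)))
        ; (inj₂ alone) → case loose-exists l of λ (φ₀ , V₀ , _) → case φ₀ x ≟ φ₀ y of λ
          { (yes eq) → φ₀ , V₀ , Slide.equal-classes alone con V₀ eq
          ; (no ne) → from (φ₀ , V₀ , ne) } }
        where
        from : (∃ λ φ₀ → Proper φ₀ × φ₀ x ≢ φ₀ y) → ∃ λ φ₀ → Proper φ₀ × Classes φ₀
        from (φ₀ , V₀ , ne) = φ₀ , V₀ , separated-classes splitA (constA con) con tightA slackA V₀ ne

      -- Here sliding the cut keeps the lists constant, since b was a vertex of B. Both sides of {b
      -- , y} have a slack vertex, so b and y can always be given different colours.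
      constantB-classes : ConstantOn B → ∃ λ φ₀ → Proper φ₀ × Classes φ₀
      constantB-classes con = case second-or-alone of λ
        { (inj₁ b′) → case two-coloured splitB splitA (constB con) rimB⊆ (good-split splitB tightB (slackB b′)) goodA of λ
            (φ₀ , V₀ , ne) → φ₀ , V₀ , separated-classes splitB (constB con) con tightB (slackB b′) V₀ ne
        ; (inj₂ alone) → slide alone }
        where
        slide : Alone → ∃ λ φ₀ → Proper φ₀ × Classes φ₀
        slide alone = case two-coloured splitB⁻ splitA⁺ (constB⁻ con) rimB⁻⊆ goodB⁻ goodA⁺ of λ
          (φ₀ , V₀ , ne) → φ₀ , V₀ , separated-classes splitB⁻ (constB⁻ con) (con ∘ proj₁) tightB⁻ slackB⁻ V₀ ne
          where open Slide alone

    -- Loose vertices on both sides of the cut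

    module Linked {x y : Fin n} (sf : SmallestFragment G A x y) where
      open Sides sf

      -- By minimality of A the graph stays connected without a and v, so one slack vertex suffices:
      -- a third vertex that loses a neighbour but no colour.
      link : ∀ {a v g c} → A ∋ a → v ≢ a → g ∈ L a → c ∈ L v → (a ∼ v → c ≢ g) →
        (∃ λ w → a ∼ w × g ∉ L w × w ≢ v) ⊎ (∃ λ w → v ∼ w × c ∉ L w × w ≢ a) →
        ∃ λ φ → Proper φ × φ a ≡ g × φ v ≡ c
      link {a} {v} {g} {c} pa ne gL cL compat third =
        fixed₂-exists {E = N} {L} {Whole} (good third) gL (∈-del {E = N} {L} {a} {g} cL compat) ne
        where
        good-at : ∀ {r} → Slack N (del N (del N L a g) v c) (Whole - a - v) r → Good N (del N (del N L a g) v c) (Whole - a - v)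
        good-at s@(((_ , ra) , rv) , _) =
          mkGood (tight-fix (tt , ne) (tight-fix tt tightG)) s (connected-without sf pa (≢-sym ne) ra rv)
        good : (∃ λ w → a ∼ w × g ∉ L w × w ≢ v) ⊎ (∃ λ w → v ∼ w × c ∉ L w × w ≢ a) → Good N (del N (del N L a g) v c) (Whole - a - v)
        good (inj₁ (w , e , g∉ , wv)) =
          good-at (slack-keep {E = N} {del N L a g} {Whole - a} (tt , ne) wv (del-unique {E = N} {L} {a} {g} uniq w) (slack-new tt tightG tt e g∉))
        good (inj₂ (w , e , c∉ , wa)) =
          good-at (slack-new {E = N} {del N L a g} {Whole - a} (tt , ne) (tight-fix tt tightG) (tt , wa) e (c∉ ∘ del-⊆ {E = N} {L} {a} {g} {w}))

      module _ {φ₀ : Colouring {n}} {a₀ g₀} (pa₀ : A ∋ a₀) (l₀ : Loose a₀ g₀)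
               (classA : ∀ {a f φ} → A ∋ a → Loose a f → Proper φ → φ a ≡ f → φ ≈ φ₀)
               (classB : ∀ {v f φ} → ¬ A ∋ v → v ≢ x → v ≢ y → Loose v f → Proper φ → φ v ≡ f → φ ≈ φ₀) where

        linked-class : ∀ {a f v c φ} → A ∋ a → v ≢ a → Loose a f → Loose v c → (a ∼ v → c ≢ f) →
          (∃ λ w → a ∼ w × f ∉ L w × w ≢ v) ⊎ (∃ λ w → v ∼ w × c ∉ L w × w ≢ a) → Proper φ → φ v ≡ c → φ ≈ φ₀
        linked-class pa ne la lv compat third V q = case link pa ne (proj₁ la) (proj₁ lv) compat third of λ
          (φ₁ , V₁ , qa , qv) → loose-class lv V V₁ q qv ◅◅ classA pa la V₁ qa

        module _ {c : ℕ} {φ : Colouring {n}} (lx : Loose x c) (V : Proper φ) (φx : φ x ≡ c) where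

          cx : c ∈ L x
          cx = proj₁ lx

          link-x : ∀ {a f} → A ∋ a → Loose a f → (x ∼ a → f ≢ c) →
            (∃ λ w → a ∼ w × f ∉ L w × w ≢ x) ⊎ (∃ λ w → x ∼ w × c ∉ L w × w ≢ a) → φ ≈ φ₀
          link-x pa la compat third = linked-class pa (λ { refl → x∉A pa }) la lx (λ e q → compat (∼sym e) (sym q)) third V φx

          -- Walk inside A from the witness w₀ to another neighbour of x; the first change of list, or the
          -- first return to a neighbour of x, gives a loose vertex of A that can be linked.
          witness-inside : ∀ {w₀} → A ∋ w₀ → x ∼ w₀ → c ∉ L w₀ → φ ≈ φ₀
          witness-inside {w₀} pw₀ e₀ c∉ =
            case Fin.any? (λ z → Fin.any? λ z′ → mem? T z ×-dec (mem? A z′ ×-dec ((adj z z′ Bool.≟ true) ×-dec ¬? (mem? T z′)))) of λ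
              { (yes (z , z′ , tz , pz′ , e , nt)) → leave tz pz′ e nt
              ; (no none) → ⊥-elim (impossible λ {u} {w} tu _ e pw → case mem? T w of λ
                  { (yes t) → t ; (no nt) → ⊥-elim (none (u , w , tu , pw , e , nt)) }) }
            where
            T : VSet n
            T = record { Mem = λ z → A ∋ z × Sub z w₀ × (z ≡ w₀ ⊎ ¬ x ∼ z)
                       ; mem? = λ z → mem? A z ×-dec (sub? z w₀ ×-dec ((z Fin.≟ w₀) ⊎-dec ¬? (adj x z Bool.≟ true))) }
            -- x has a second neighbour in A, which T excludes, although A is connected.
            impossible : (∀ {u w} → T ∋ u → A ∋ u → u ∼ w → A ∋ w → T ∋ w) → ⊥
            impossible cl with two-neighbours w₀
            ... | a , pa , e , ne with connected-inside pw₀ T (pw₀ , (λ _ p → p) , inj₁ refl) cl pa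
            ...   | _ , _ , r = [ ne , (λ nx → nx e) ]′ r
            leave : ∀ {z z′} → T ∋ z → A ∋ z′ → z ∼ z′ → ¬ T ∋ z′ → φ ≈ φ₀
            leave {z} {z′} (pz , sz , _) pz′ e nt = case sub-or-not z′ z of λ
              { (inj₂ (f , fL , f∉)) → case adj x z′ Bool.≟ true of λ
                { (no nx) → link-x pz′ (fL , z , ∼sym e , f∉) (λ ex → ⊥-elim (nx ex)) (inj₂ (w₀ , e₀ , c∉ , ne f∉ fL))
                ; (yes ex) → case sub-or-not z′ x of λ
                  { (inj₂ (d , dL , d∉)) → link-x pz′ (dL , x , ∼sym ex , d∉) (λ _ q → d∉ (subst (_∈ L x) (sym q) cx)) (inj₂ (w₀ , e₀ , c∉ , ne f∉ fL))
                  -- z′ now has the list of x, which contains c. So d, missing at z′, differs from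
                  -- c, and z can be linked with z′ as its witness.
                  ; (inj₁ s) → case difference fL f∉ of λ (d , dL , d∉) →
                      link-x pz (dL , z′ , e , d∉) (λ _ q → d∉ (sub-sym s d (subst (_∈ L x) (sym q) cx))) (inj₁ (z′ , e , d∉ , λ { refl → x∉A pz′ })) } }
              ; (inj₁ s) → return s (adj x z′ Bool.≟ true) }
              where
              ne : ∀ {f} → f ∉ L z → f ∈ L z′ → w₀ ≢ z′
              ne f∉ fL refl = f∉ (sub-sym sz _ fL)
              return : Sub z′ z → Dec (x ∼ z′) → φ ≈ φ₀
              return s (no nx) = ⊥-elim (nt (pz′ , (λ d m → sz d (s d m)) , inj₂ nx))
              -- The list of z′ is that of w₀ and lacks c, so it has some d missing at x. This d
              -- differs from c and is loose at z′ with witness x.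
              return s (yes ex) = case difference cx (λ m → c∉ (sz c (s c m))) of λ (d , dL , d∉) →
                link-x pz′ (dL , x , ∼sym ex , d∉) (λ _ q → d∉ (subst (_∈ L x) (sym q) cx))
                  (inj₂ (w₀ , e₀ , c∉ , λ { refl → nt (pz′ , (λ d m → sz d (s d m)) , inj₁ refl) }))

          -- If no vertex of A can be linked, A ∪ {x} has constant lists and a swap inside it moves x off c.
          module Outside {w₀ : Fin n} (nw₀ : ¬ A ∋ w₀) (e₀ : x ∼ w₀) (c∉w₀ : c ∉ L w₀) where

            module Unlinked (adjacent : ∀ {a w} → A ∋ a → a ∼ w → ¬ Sub a w → x ∼ a)
                            (only-c : ∀ {a w f} → A ∋ a → a ∼ w → f ∈ L a → f ∉ L w → f ≡ c) where

              -- If the lists of two neighbours differed, each would have a colour missing from the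
              -- other; both colours would be c.
              constant-in-A : ∀ {a a′} → A ∋ a → A ∋ a′ → a ∼ a′ → Sub a a′
              constant-in-A {a} {a′} pa pa′ e = case sub-or-not a a′ of λ
                { (inj₁ s) → s
                ; (inj₂ (f , fL , f∉)) → case difference fL f∉ of λ (d , dL , d∉) →
                    ⊥-elim (d∉ (subst (_∈ L a) (trans (only-c pa e fL f∉) (sym (only-c pa′ (∼sym e) dL d∉))) fL)) }

              next-to-x : ∀ {a} → A ∋ a → x ∼ a → Sub a x
              next-to-x {a} pa e = case sub-or-not a x of λ
                { (inj₁ s) → s ; (inj₂ (f , fL , f∉)) → ⊥-elim (f∉ (subst (_∈ L x) (sym (only-c pa (∼sym e) fL f∉)) cx)) }

              like-x : ∀ {a} → A ∋ a → Sub a x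
              like-x pa with two-neighbours x
              ... | a₁ , pa₁ , e₁ , _ = proj₂ (connected-inside pa₁ T (pa₁ , next-to-x pa₁ e₁)
                      (λ (_ , s) pu e pw → pw , λ d m → s d (constant-in-A pw pu (∼sym e) d m)) pa)
                where
                T : VSet n
                T = record { Mem = λ z → A ∋ z × Sub z x ; mem? = λ z → mem? A z ×-dec sub? z x }

              w₁ : Fin n
              w₁ = proj₁ (proj₂ l₀)

              a₀∼w₁ : a₀ ∼ w₁
              a₀∼w₁ = proj₁ (proj₂ (proj₂ l₀))

              g₀∉w₁ : g₀ ∉ L w₁
              g₀∉w₁ = proj₂ (proj₂ (proj₂ l₀))

              g₀≡c : g₀ ≡ c
              g₀≡c = only-c pa₀ a₀∼w₁ (proj₁ l₀) g₀∉w₁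

              -- The lists on A and at x agree, so the witness of the loose pair `a₀`, `g₀` can only
              -- be y, and g₀ is c.
              c∉y : c ∉ L y
              c∉y = case boundary pa₀ a₀∼w₁ (λ pw → g₀∉w₁ (constant-in-A pa₀ pw a₀∼w₁ _ (proj₁ l₀))) of λ
                { (inj₁ q) → ⊥-elim (g₀∉w₁ (subst (λ z → g₀ ∈ L z) (sym q) (like-x pa₀ _ (proj₁ l₀))))
                ; (inj₂ q) m → g₀∉w₁ (subst (λ z → g₀ ∈ L z) (sym q) (subst (_∈ L y) (sym g₀≡c) m)) }

              c∈A : ∀ {a} → A ∋ a → c ∈ L a
              c∈A pa = sub-sym (like-x pa) c cx

              y-neighbour : ∀ {a} → A ∋ a → a ∼ y → x ∼ a
              y-neighbour pa e = adjacent pa e λ s → c∉y (s c (c∈A pa))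

              -- With two neighbours in A, x has at most k - 2 outside; together with c at most k -
              -- 1 colours are excluded.
              fresh : ∃ λ h → h ∈ L x × h ∉ c ∷ map φ (members (Nb N (∁ A) x))
              fresh with two-neighbours x
              ... | z , pz , e , _ with two-neighbours z
              ...   | z′ , pz′ , e′ , ne = free-element (c ∷ map φ (members (Nb N (∁ A) x))) (uniq x)
                        (subst (λ m → suc m < length (L x)) (sym (length-map φ (members (Nb N (∁ A) x))))
                          (subst (suc (deg N (∁ A) x) <_) (sym (len x)) (deg-miss₂ (∁ A) e (λ q → q pz) e′ (λ q → q pz′) (≢-sym ne))))

              h : ℕ
              h = proj₁ fresh
              h∈ : h ∈ L x
              h∈ = proj₁ (proj₂ fresh)
              h≢c : h ≢ c
              h≢c q = proj₂ (proj₂ fresh) (here q)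
              h-free : ∀ {w} → x ∼ w → ¬ A ∋ w → φ w ≢ h
              h-free e nw q = proj₂ (proj₂ fresh) (there (subst (_∈ _) q (∈-map⁺ φ (∈-members (Nb N (∁ A) x) (e , nw)))))

              W : VSet n
              W = record { Mem = λ u → (A ∋ u ⊎ u ≡ x) × AB c h (φ u)
                         ; mem? = λ u → (mem? A u ⊎-dec (u Fin.≟ x)) ×-dec ab? c h (φ u) }

              W-closed : ∀ {u w} → W ∋ u → u ∼ w → AB c h (φ w) → A ∋ w ⊎ w ≡ x
              W-closed {u} {w} (inj₂ refl , _) e abw = case mem? A w of λ
                { (yes aw) → inj₁ aw
                ; (no nw) → ⊥-elim ([ (λ q → proper V tt tt e (trans φx (sym q))) , h-free e nw ]′ abw) }
              W-closed {u} {w} (inj₁ au , abu) e abw = case mem? A w of λ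
                { (yes aw) → inj₁ aw
                ; (no nw) → case boundary au e nw of λ
                  { (inj₁ q) → inj₂ q
                  ; (inj₂ refl) → ⊥-elim (meet-y e abu abw (y-neighbour au e)) } }
                where
                -- y cannot have colour c. If it has h while u has c, then u, as a neighbour of y in
                -- A, is also adjacent to x, which has c too.
                meet-y : u ∼ y → AB c h (φ u) → AB c h (φ y) → x ∼ u → ⊥
                meet-y _ _ (inj₁ q) _ = c∉y (subst (_∈ L y) q (listed V tt))
                meet-y _ (inj₁ p) (inj₂ _) ex = proper V tt tt ex (trans φx (sym p))
                meet-y e (inj₂ p) (inj₂ q) _ = proper V tt tt e (trans p (sym q))

              kW : KempeSet N Whole φ c h W
              kW .inside _ = tt
              kW .bicol = proj₂
              kW .closed m e _ ab = W-closed m e ab , ab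

              ψ : Colouring {n}
              ψ = swapOn c h W φ

              inL : ∀ {u} → W ∋ u → sw c h (φ u) ∈ L u
              inL (inj₁ au , _) = sw-∈ (c∈A au) (sub-sym (like-x au) h h∈) (listed V tt)
              inL (inj₂ refl , _) = sw-∈ cx h∈ (listed V tt)

              move : φ ≈ ψ
              move = swapOn-move V kW inL ◅ ε

              vψ : Proper ψ
              vψ = steps-valid V move

              ψx : ψ x ≡ h
              ψx = trans (swapOn-in c h W φ (inj₂ refl , inj₁ φx)) (trans (cong (sw c h) φx) (sw-α c h))

              -- The clash is gone: x now has h, while the loose colour of a₀ is c.
              at-x : Loose x (ψ x) → ψ ≈ φ₀
              at-x lψ@(_ , w , e , nm) = linked-class pa₀ (λ { refl → x∉A pa₀ }) l₀ lψ (λ _ q → h≢c (trans (sym ψx) (trans q g₀≡c)))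
                (inj₂ (w , e , nm , λ { refl → nm (subst (_∈ L w) (sym ψx) (sub-sym (like-x pa₀) h h∈)) })) vψ refl

              -- c is loose at every neighbour of y in A, and minimality offers one other than w; y
              -- itself cannot have colour c.
              at-y : Loose y (ψ y) → ψ ≈ φ₀
              at-y lψ@(m , w , e , nm) = case Smallest.two-neighbours (smallest-swap sf) w of λ (a , pa , ea , ne) →
                linked-class pa (λ { refl → y∉A pa }) (c∈A pa , y , ∼sym ea , c∉y) lψ (λ _ q → c∉y (subst (_∈ L y) q m))
                  (inj₂ (w , e , nm , ≢-sym ne)) vψ refl

              resolved : φ ≈ φ₀
              resolved = move ◅◅ (case nonloose-or vψ of λ
                { (inj₁ nl) → case nonloose-reaches vψ nl (proj₁ l₀) of λ (χ , s , q) → s ◅◅ classA pa₀ l₀ (steps-valid vψ s) q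
                ; (inj₂ (z , lz)) → at z lz (mem? A z) (z Fin.≟ x) (z Fin.≟ y) })
                where
                at : ∀ z → Loose z (ψ z) → Dec (A ∋ z) → Dec (z ≡ x) → Dec (z ≡ y) → ψ ≈ φ₀
                at z lz (yes pz) _ _ = classA pz lz vψ refl
                at z lz (no _) (yes refl) _ = at-x lz
                at z lz (no _) (no _) (yes refl) = at-y lz
                at z lz (no nz) (no zx) (no zy) = classB nz zx zy lz vψ refl

            third-party : ∀ {a} → A ∋ a → ∃ λ w → x ∼ w × c ∉ L w × w ≢ a
            third-party pa = w₀ , e₀ , c∉w₀ , λ { refl → nw₀ pa }

            resolve : φ ≈ φ₀
            resolve =
              case Fin.any? (λ a → Fin.any? λ w → mem? A a ×-dec ((adj a w Bool.≟ true) ×-dec (¬? (sub? a w) ×-dec ¬? (adj x a Bool.≟ true)))) of λ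
              { (yes (a , w , pa , e , ns , nx)) → case sub-or-not a w of λ
                { (inj₁ s) → ⊥-elim (ns s)
                ; (inj₂ (f , fL , f∉)) → link-x pa (fL , w , e , f∉) (λ ex → ⊥-elim (nx ex)) (inj₂ (third-party pa)) }
              ; (no none₁) →
              case Fin.any? (λ a → Fin.any? λ w → mem? A a ×-dec ((adj a w Bool.≟ true) ×-dec ¬? (within? (L a) (c ∷ L w)))) of λ
              { (yes (a , w , pa , e , nw)) → case subset-or-not (L a) (c ∷ L w) of λ
                { (inj₁ s) → ⊥-elim (nw (All.tabulate s))
                ; (inj₂ (f , fL , f∉)) → link-x pa (fL , w , e , f∉ ∘ there) (λ _ q → f∉ (here q)) (inj₂ (third-party pa)) }
              ; (no none₂) → Unlinked.resolved
                  (λ {a} {w} pa e ns → case adj x a Bool.≟ true of λ { (yes p) → p ; (no nx) → ⊥-elim (none₁ (a , w , pa , e , ns , nx)) })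
                  (λ {a} {w} {f} pa e fL f∉ → case within? (L a) (c ∷ L w) of λ
                    { (no nw) → ⊥-elim (none₂ (a , w , pa , e , nw))
                    ; (yes s) → case All.lookup s fL of λ { (here q) → q ; (there m) → ⊥-elim (f∉ m) } }) } }
              where
              within? : ∀ xs ys → Dec (All.All (_∈ ys) xs)
              within? xs ys = All.all? (_∈? ys) xs

          class-x : φ ≈ φ₀
          class-x = case lx of λ (_ , w₀ , e₀ , c∉) → case mem? A w₀ of λ
            { (yes pw) → witness-inside pw e₀ c∉ ; (no nw) → Outside.resolve nw e₀ c∉ }

    open Sides sf₀

    link-AB : ∀ {a g b d} → A ∋ a → Loose a g → B ∋ b → Loose b d → ∃ λ φ → Proper φ × φ a ≡ g × φ b ≡ d
    link-AB {a} {b = b} pa (gL , w , e , g∉) ((nb , bx) , by) (dL , _) =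
      Linked.link sf₀ pa (λ { refl → nb pa }) gL dL (λ e′ → ⊥-elim (apart e′)) (inj₁ (w , e , g∉ , λ { refl → apart e }))
      where
      apart : ¬ a ∼ b
      apart e = [ bx , by ]′ (boundary pa e nb)

    both-loose-classes : (∃₂ λ a g → A ∋ a × Loose a g) → (∃₂ λ b d → B ∋ b × Loose b d) → ∃ λ φ₀ → Proper φ₀ × Classes φ₀
    both-loose-classes (a₀ , g₀ , pa₀ , l₀) (b₀ , d₀ , pb₀ , lb₀) =
      case link-AB pa₀ l₀ pb₀ lb₀ of λ (φ₀ , V₀ , qa₀ , qb₀) → φ₀ , V₀ , classes V₀ qa₀ qb₀
      where
      module _ {φ₀ : Colouring {n}} (V₀ : Proper φ₀) (qa₀ : φ₀ a₀ ≡ g₀) (qb₀ : φ₀ b₀ ≡ d₀) where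
        classA : ∀ {a f φ} → A ∋ a → Loose a f → Proper φ → φ a ≡ f → φ ≈ φ₀
        classA pa la V q = case link-AB pa la pb₀ lb₀ of λ
          (φ₁ , V₁ , qa , qb) → loose-class la V V₁ q qa ◅◅ loose-class lb₀ V₁ V₀ qb qb₀
        classB : ∀ {b f φ} → ¬ A ∋ b → b ≢ x₀ → b ≢ y₀ → Loose b f → Proper φ → φ b ≡ f → φ ≈ φ₀
        classB nb bx by lb V q = case link-AB pa₀ l₀ (∈B nb bx by) lb of λ
          (φ₁ , V₁ , qa , qb) → loose-class lb V V₁ q qb ◅◅ loose-class l₀ V₁ V₀ qa qa₀
        at : ∀ v {c φ} → Loose v c → Proper φ → φ v ≡ c → Dec (A ∋ v) → Dec (v ≡ x₀) → Dec (v ≡ y₀) → φ ≈ φ₀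
        at v l V q (yes pv) _ _ = classA pv l V q
        at v l V q (no _) (yes refl) _ = Linked.class-x sf₀ pa₀ l₀ classA classB l V q
        at v l V q (no _) (no _) (yes refl) = Linked.class-x (smallest-swap sf₀) pa₀ l₀ classA (λ a p r → classB a r p) l V q
        at v l V q (no nv) (no vx) (no vy) = classB nv vx vy l V q
        classes : Classes φ₀
        classes v c φ l V q = at v l V q (mem? A v) (v Fin.≟ x₀) (v Fin.≟ y₀)

    -- All lists equal

    module ConstantLists (conA : ConstantOn A) (conB : ConstantOn B) where

      x y : Fin n
      x = x₀
      y = y₀

      same : ∀ {u} w → Sub u w
      same {u} w c m = sub-sym (to-x w) c (to-x u c m)
        where
        to-x : ∀ u → Sub u x
        to-x u = case mem? A u of λ
          { (yes au) → constA conA (inj₁ au) (inj₂ (inj₁ refl))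
          ; (no nu) → case mem? B u of λ
            { (yes bu) → constB conB (inj₁ bu) (inj₂ (inj₁ refl))
            ; (no nb) → constA conA (case B∌ nb of λ { (inj₁ au) → inj₁ au ; (inj₂ r) → inj₂ r }) (inj₂ (inj₁ refl)) } }

      a : Fin n
      a = proj₁ (two-neighbours x)
      a∈A : A ∋ a
      a∈A = proj₁ (proj₂ (two-neighbours x))
      x∼a : x ∼ a
      x∼a = proj₁ (proj₂ (proj₂ (two-neighbours x)))
      a≢x : a ≢ x
      a≢x q = x∉A (subst (A ∋_) q a∈A)
      a≢y : a ≢ y
      a≢y q = y∉A (subst (A ∋_) q a∈A)
      b≢a : b ≢ a
      b≢a q = b∉A (subst (A ∋_) (sym q) a∈A)
      a≁b : ¬ a ∼ b
      a≁b e = [ b≢x , b≢y ]′ (boundary a∈A e b∉A)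

      c∈del-b : ∀ {c} → c ∈ L a → c ∈ del N L a c b
      c∈del-b {c} m = ∈-del {E = N} {L} {a} {c} (same b c m) (λ e → ⊥-elim (a≁b e))

      -- x loses the two neighbours a and b but only the one colour c, so it becomes slack.
      good-ab : ∀ c → Good N (del N (del N L a c) b c) (Whole - a - b)
      good-ab c = mkGood (tight-fix (tt , b≢a) (tight-fix tt tightG))
        (slack-new {E = N} {del N L a c} {Whole - a} (tt , b≢a) (tight-fix tt tightG) (tt , ≢-sym a≢x) (∼sym x∼b)
          (λ m → del-≢ {E = N} {L} {a} {c} {x} (∼sym x∼a) m refl))
        (connected-without sf₀ a∈A (≢-sym b≢a) (≢-sym a≢x) (≢-sym b≢x))

      colour-class : ∀ {c φ ψ} → Proper φ → Proper ψ → φ a ≡ c → φ b ≡ c → ψ a ≡ c → ψ b ≡ c → φ ≈ ψ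
      colour-class {c} {φ} {ψ} vφ vψ φa φb ψa ψb =
        case fixed₂-class {E = N} {L} {Whole} (good-ab c) tt tt b≢a c∈a (c∈del-b c∈a) vφ vψ φa ψa φb ψb of λ
          (χ , s , eq) → agree-≈ vφ s eq
        where
        c∈a : c ∈ L a
        c∈a = subst (_∈ L a) φa (listed vφ tt)

      base-colouring : ∃ λ φ → Proper φ × φ a ≡ φ b
      base-colouring = case free-element [] (uniq a) (subst (0 <_) (sym (len a)) (≤-trans (s≤s z≤n) k≥3)) of λ
        (c , m , _) → case fixed₂-exists {E = N} {L} {Whole} (good-ab c) m (c∈del-b m) b≢a of λ
          (φ , V , p , q) → φ , V , trans p (sym q)

      -- Since all lists agree, α and β may be exchanged on the whole of G, which gives a and b
      -- their common colour under ψ.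
      equal-class : ∀ {φ ψ} → Proper φ → Proper ψ → φ a ≡ φ b → ψ a ≡ ψ b → φ ≈ ψ
      equal-class {φ} {ψ} vφ vψ p q = move ◅◅ colour-class (steps-valid vφ move) vψ (at a refl) (at b (sym p)) refl (sym q)
        where
        α β : ℕ
        α = φ a
        β = ψ a
        W : VSet n
        W = record { Mem = λ u → AB α β (φ u) ; mem? = λ u → ab? α β (φ u) }
        move : φ ≈ swapOn α β W φ
        move = swapOn-move vφ record { inside = λ _ → tt ; bicol = id ; closed = λ _ _ _ ab → ab }
          (λ {v} _ → sw-∈ (same v _ (listed vφ {a} tt)) (same v _ (listed vψ {a} tt)) (listed vφ tt)) ◅ ε
        at : ∀ v → φ v ≡ α → swapOn α β W φ v ≡ β
        at v r = trans (swapOn-in α β W φ (inj₁ r)) (trans (cong (sw α β) r) (sw-α α β))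

      module _ {φ₀ : Colouring {n}} (V₀ : Proper φ₀) (q₀ : φ₀ a ≡ φ₀ b) where

        -- If y has neither colour of a and b, the chain through a stays inside A.
        y-distinct : ∀ {φ} → Proper φ → φ a ≢ φ y → φ b ≢ φ y → φ ≈ φ₀
        y-distinct {φ} V na nb = move ◅◅ equal-class (steps-valid V move) V₀ (trans at-a (sym at-b)) q₀
          where
          α β : ℕ
          α = φ a
          β = φ b
          W : VSet n
          W = record { Mem = λ u → A ∋ u × AB α β (φ u) ; mem? = λ u → mem? A u ×-dec ab? α β (φ u) }
          stays : ∀ {u w} → A ∋ u → u ∼ w → AB α β (φ w) → A ∋ w
          stays {u} {w} au e ab = case mem? A w of λ
            { (yes aw) → aw
            ; (no nw) → ⊥-elim ([ (λ q → [ (λ r → proper V tt tt x∼a (trans (cong φ (sym q)) r)) , (λ r → proper V tt tt x∼b (trans (cong φ (sym q)) r)) ]′ ab)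
                                , (λ q → [ (λ r → na (trans (sym r) (cong φ q))) , (λ r → nb (trans (sym r) (cong φ q))) ]′ ab) ]′ (boundary au e nw)) }
          move : φ ≈ swapOn α β W φ
          move = swapOn-move V record { inside = λ _ → tt ; bicol = proj₂ ; closed = λ (au , _) e _ ab → stays au e ab , ab }
            (λ {v} _ → sw-∈ (same v _ (listed V {a} tt)) (same v _ (listed V {b} tt)) (listed V tt)) ◅ ε
          at-a : swapOn α β W φ a ≡ β
          at-a = trans (swapOn-in α β W φ (a∈A , inj₁ refl)) (sw-α α β)
          at-b : swapOn α β W φ b ≡ β
          at-b = swapOn-out α β W φ (λ (ab , _) → b∉A ab)

        -- B is coloured greedily, its vertices with neighbours outside being slack. Having two
        -- neighbours in A, y can avoid its neighbours in B and the colour of b besides; x comes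
        -- last, with the spare colour of `slackA`.
        target-B : ∃ λ θ → Valid (E⁺ splitA) L (U splitA) θ × θ b ≢ θ y
        target-B = θ₃ , v₃ , λ q → c≢ (trans (sym (trans (upd-other θ₂ (≢-sym x≢y)) (upd-same θ₁ y c))) (trans (sym q)
                       (trans (upd-other θ₂ b≢x) (upd-other θ₁ b≢y))))
          where
          goodB : Good N L B
          goodB = record { uniq = uniq ; tight = tightᵗ (tight-⊆ Whole B (λ _ → tt) tightG) ; reach = reach-B }
            where
            reach-B : ∀ T → (∀ {r} → B ∋ r → deg N B r < length (L r) → T ∋ r) →
              (∀ {u w} → T ∋ u → B ∋ u → u ∼ w → B ∋ w → T ∋ w) → ∀ {w} → B ∋ w → T ∋ w
            reach-B T sl cl {w} bw = case mem? T w of λ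
              { (yes t) → t
              ; (no nt) → ⊥-elim (Split.x∉R splitB (proj₁ (2conn y S (bw , nt) (λ { refl → Split.y∉R splitB bw }) closed′ x≢y))) }
              where
              S : VSet n
              S = record { Mem = λ v → B ∋ v × ¬ T ∋ v ; mem? = λ v → mem? B v ×-dec ¬? (mem? T v) }
              closed′ : ∀ {p q} → S ∋ p → p ≢ y → p ∼ q → q ≢ y → S ∋ q
              closed′ {p} {q} (bp , np) _ e q≢ = case mem? B q of λ
                { (yes bq) → bq , λ tq → np (cl tq bq (∼sym e) bp)
                ; (no nq) → ⊥-elim (np (sl bp (subst (deg N B p <_) (sym (len p)) (deg-miss B e nq)))) }
          θ₁ : Colouring {n}
          θ₁ = proj₁ (good-colorable goodB)
          v₁ : Valid N L B θ₁
          v₁ = proj₂ (good-colorable goodB)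
          taken : List ℕ
          taken = θ₁ b ∷ map θ₁ (members (Nb N B y))
          y-free : ∃ λ c → c ∈ L y × c ∉ taken
          y-free = case Smallest.two-neighbours (smallest-swap sf₀) x of λ
            (z , az , e , _) → case Smallest.two-neighbours (smallest-swap sf₀) z of λ
            (z′ , az′ , e′ , ne) → free-element taken (uniq y)
              (subst (λ m → suc m < length (L y)) (sym (length-map θ₁ (members (Nb N B y))))
                (subst (suc (deg N B y) <_) (sym (len y))
                  (deg-miss₂ B e (λ ((nz , _) , _) → nz az) e′ (λ ((nz , _) , _) → nz az′) (≢-sym ne))))
          c : ℕ
          c = proj₁ y-free
          c≢ : c ≢ θ₁ b
          c≢ q = proj₂ (proj₂ y-free) (here q)
          θ₂ : Colouring {n}
          θ₂ = θ₁ [ y ↦ c ]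
          real : ∀ {u w} → B ∋ u → B ∋ w → Edge (E⁺ splitA) u w → u ∼ w
          real _ _ (inj₁ e) = e
          real ((_ , ux) , _) _ (inj₂ (inj₁ (q , _))) = ⊥-elim (ux q)
          real _ ((_ , wx) , _) (inj₂ (inj₂ (_ , q))) = ⊥-elim (wx q)
          v₁′ : Valid (E⁺ splitA) L (∁ A - x - y) θ₁
          v₁′ = valid (λ bu bw e → proper v₁ bu bw (real bu bw e)) (λ bu → listed v₁ bu)
          v₂ : Valid (E⁺ splitA) L (∁ A - x) θ₂
          v₂ = extend {E = E⁺ splitA} {L} {∁ A - x} v₁′ (proj₁ (proj₂ y-free)) free
            where
            free : ∀ {u} → (∁ A - x) ∋ u → Edge (E⁺ splitA) y u → θ₁ u ≢ c
            free {u} (nu , ux) (inj₁ e) q =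
              proj₂ (proj₂ y-free) (there (subst (_∈ _) q (∈-map⁺ θ₁ (∈-members (Nb N B y) {u} (e , (nu , ux) , λ { refl → eirr N e })))))
            free _ (inj₂ (inj₁ (q , _))) _ = x≢y (sym q)
            free (_ , ux) (inj₂ (inj₂ (_ , q))) _ = ux q
          x-free : ∃ λ c → c ∈ L x × (∀ {u} → ∁ A ∋ u → Edge (E⁺ splitA) x u → θ₂ u ≢ c)
          x-free = avoid-neighbours {E = E⁺ splitA} {L} {∁ A} θ₂ (uniq x) (proj₂ slackA)
          θ₃ : Colouring {n}
          θ₃ = θ₂ [ x ↦ proj₁ x-free ]
          v₃ : Valid (E⁺ splitA) L (U splitA) θ₃
          v₃ = extend {E = E⁺ splitA} {L} {∁ A} v₂ (proj₁ (proj₂ x-free)) (proj₂ (proj₂ x-free))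

        -- x differs from y because its neighbour b has the colour of y, so the side beyond A can be
        -- recoloured to make b and y differ; K = `_≡ a` keeps a different from y meanwhile.
        y-like-b : ∀ {φ} → Proper φ → φ a ≢ φ y → φ b ≡ φ y → φ ≈ φ₀
        y-like-b {φ} V na qb = case target-B of λ (θ , vθ , ne) →
          case lift-separated splitA (constA conA) (_≡ a) goodA V ((λ q → proper V tt tt x∼b (trans q (sym qb))) , λ { refl → a∈A , na }) vθ of λ
            (ψ , s , (_ , keep) , agree) → s ◅◅ y-distinct (steps-valid V s) (proj₂ (keep refl))
              (λ q → ne (trans (sym (agree b∉A)) (trans q (agree y∉A))))

        Ay : VSet n
        Ay = A ∪₁ y

        Eay : Net n
        Eay = joined a y a≢y

        -- A second neighbour of x in A is slack once x is removed, even with a and y joined.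
        target-A : ∃ λ θ → Valid Eay L Ay θ
        target-A = good-colorable (mkGood tight-Ay slack-Ay connected-Ay)
          where
          a₂ : Fin n
          a₂ = proj₁ (two-neighbours a)
          a₂∈A : A ∋ a₂
          a₂∈A = proj₁ (proj₂ (two-neighbours a))
          x∼a₂ : x ∼ a₂
          x∼a₂ = proj₁ (proj₂ (proj₂ (two-neighbours a)))
          a₂≢a : a₂ ≢ a
          a₂≢a = proj₂ (proj₂ (proj₂ (two-neighbours a)))
          x∉Ay : ¬ Ay ∋ x
          x∉Ay = [ x∉A , x≢y ]′
          tight-Ay : Tight Eay L Ay
          tight-Ay = tight-joined a≢y Ay (x , ∼sym x∼a , λ (p , _) → x∉Ay p)
            (case y-in-B of λ (z , ((nz , _) , zy) , e) → z , e , λ (p , _) → [ nz , zy ]′ p)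
          slack-Ay : Slack Eay L Ay a₂
          slack-Ay = inj₁ a₂∈A , subst (deg Eay Ay a₂ <_) (sym (len a₂))
            (≤-trans (s≤s (size-mono (Nb Eay Ay a₂) (Nb N Ay a₂) real)) (deg-miss Ay (∼sym x∼a₂) x∉Ay))
            where
            real : ∀ {u} → Nb Eay Ay a₂ ∋ u → Nb N Ay a₂ ∋ u
            real (inj₁ e , p) = e , p
            real (inj₂ (inj₁ (q , _)) , _) = ⊥-elim (a₂≢a q)
            real (inj₂ (inj₂ (q , _)) , _) = ⊥-elim (y∉A (subst (A ∋_) q a₂∈A))
          -- Such a part could be left only through x, which alone would then separate it from y.
          no-piece : ∀ (S : VSet n) {s} → S ∋ s → (∀ {v} → S ∋ v → Ay ∋ v) → ¬ S ∋ y →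
            (∀ {v w} → S ∋ v → v ∼ w → Ay ∋ w → S ∋ w) → ⊥
          no-piece S s∈ S⊆ ny cl = ny (2conn x S s∈ (λ { refl → x∉Ay (S⊆ s∈) }) closed′ (≢-sym x≢y))
            where
            closed′ : ∀ {p q} → S ∋ p → p ≢ x → p ∼ q → q ≢ x → S ∋ q
            closed′ {p} {q} sp _ e q≢ = cl sp e (case S⊆ sp of λ
              { (inj₂ refl) → ⊥-elim (ny sp)
              ; (inj₁ ap) → case mem? A q of λ
                { (yes aq) → inj₁ aq ; (no nq) → case boundary ap e nq of λ { (inj₁ r) → ⊥-elim (q≢ r) ; (inj₂ r) → inj₂ r } } })
          connected-Ay : Conn Eay Ay a₂
          connected-Ay T ta cl {w} pw = case mem? T w of λ
            { (yes t) → t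
            ; (no nt) → ⊥-elim (case mem? T y of λ
              { (yes ty) → no-piece (record { Mem = λ v → Ay ∋ v × ¬ T ∋ v ; mem? = λ v → mem? Ay v ×-dec ¬? (mem? T v) })
                  (pw , nt) proj₁ (λ (_ , q) → q ty) (λ (pv , nv) e pw → pw , λ tw → nv (cl tw pw (inj₁ (∼sym e)) pv))
              ; (no nty) → no-piece (record { Mem = λ v → Ay ∋ v × T ∋ v ; mem? = λ v → mem? Ay v ×-dec mem? T v })
                  (inj₁ a₂∈A , ta) proj₁ (λ (_ , q) → nty q) (λ (pv , tv) e pw → pw , cl tv pv (inj₁ e) pw) }) }

        target-A-distinct : ∀ {θ} → Valid Eay L Ay θ → θ a ≢ θ y
        target-A-distinct v = proper v (inj₁ a∈A) (inj₂ refl) (inj₂ (inj₁ (refl , refl)))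

        -- The mirror image of `y-like-b`, recolouring the side of A. The target must still be
        -- extended to x, and also to b if the cut has to be moved to {b , y}.
        y-like-a : ∀ {φ} → Proper φ → φ a ≡ φ y → φ b ≢ φ y → φ ≈ φ₀
        y-like-a {φ} V qa nb = case target-A of λ (θ₀ , v₀) → case second-or-alone of λ
          { (inj₁ b′) → through-B b′ v₀ ; (inj₂ alone) → through-slide alone v₀ }
          where
          through-B : ∀ {θ₀} → (∃ λ b′ → x ∼ b′ × ¬ A ∋ b′ × b′ ≢ b) → Valid Eay L Ay θ₀ → φ ≈ φ₀
          through-B {θ₀} b′ v₀ = case avoid-neighbours {E = E⁺ splitB} {L} {∁ B} θ₀ (uniq x) (proj₂ (slackB b′)) of λ
            (c , cL , free) → finish (extend {E = E⁺ splitB} {L} {∁ B} v₀′ cL free)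
            where
            toAy : ∀ {u} → (∁ B - x) ∋ u → Ay ∋ u
            toAy (nu , ux) = case B∌ nu of λ { (inj₁ au) → inj₁ au ; (inj₂ (inj₁ q)) → ⊥-elim (ux q) ; (inj₂ (inj₂ q)) → inj₂ q }
            v₀′ : Valid (E⁺ splitB) L (∁ B - x) θ₀
            v₀′ = valid pr (λ p → listed v₀ (toAy p))
              where
              pr : ∀ {u w} → (∁ B - x) ∋ u → (∁ B - x) ∋ w → Edge (E⁺ splitB) u w → θ₀ u ≢ θ₀ w
              pr p q (inj₁ e) = proper v₀ (toAy p) (toAy q) (inj₁ e)
              pr (_ , ux) _ (inj₂ (inj₁ (r , _))) = ⊥-elim (ux r)
              pr _ (_ , wx) (inj₂ (inj₂ (_ , r))) = ⊥-elim (wx r)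
            finish : ∀ {c} → Valid (E⁺ splitB) L (∁ B) (θ₀ [ x ↦ c ]) → φ ≈ φ₀
            finish {c} vθ = case lift-separated splitB (constB conB) (_≡ b) (good-split splitB tightB (slackB b′)) V
                ((λ q → proper V tt tt x∼a (trans q (sym qa))) , λ { refl → b∈B , nb }) vθ of λ
              (ψ , s , (_ , keep) , agree) → s ◅◅ y-distinct (steps-valid V s)
                (λ q → target-A-distinct v₀ (trans (sym (upd-other θ₀ {c = c} a≢x)) (trans (sym (agree (rimA⊆ (inj₁ a∈A))))
                  (trans q (trans (agree (Split.y∉R splitB)) (upd-other θ₀ (≢-sym x≢y)))))))
                (proj₂ (keep refl))
          through-slide : ∀ {θ₀} → Alone → Valid Eay L Ay θ₀ → φ ≈ φ₀
          -- While b is uncoloured, x has a spare colour; b follows, with the spare colour of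
          -- `slackB⁻`.
          through-slide {θ₀} alone v₀ = case avoid-neighbours {E = E⁺ splitB⁻} {L} {∁ B⁻ - b} θ₀ (uniq x) small of λ
            (c , cL , free) → let v₁ = extend {E = E⁺ splitB⁻} {L} {∁ B⁻ - b} {r = x} v₀′ cL free in
            case avoid-neighbours {E = E⁺ splitB⁻} {L} {∁ B⁻} (θ₀ [ x ↦ c ]) (uniq b) (proj₂ slackB⁻) of λ
            (d , dL , free′) → finish (extend {E = E⁺ splitB⁻} {L} {∁ B⁻} v₁ dL free′)
            where
            open Slide alone
            toAy : ∀ {u} → (∁ B⁻ - b - x) ∋ u → Ay ∋ u
            toAy ((nu , ub) , ux) = case B∌ (λ bu → nu (bu , ub)) of λ
              { (inj₁ au) → inj₁ au ; (inj₂ (inj₁ q)) → ⊥-elim (ux q) ; (inj₂ (inj₂ q)) → inj₂ q }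
            real : ∀ {u w} → u ≢ b → w ≢ b → Edge (E⁺ splitB⁻) u w → u ∼ w
            real _ _ (inj₁ e) = e
            real ub _ (inj₂ (inj₁ (r , _))) = ⊥-elim (ub r)
            real _ wb (inj₂ (inj₂ (_ , r))) = ⊥-elim (wb r)
            v₀′ : Valid (E⁺ splitB⁻) L (∁ B⁻ - b - x) θ₀
            v₀′ = valid (λ p q e → proper v₀ (toAy p) (toAy q) (inj₁ (real (proj₂ (proj₁ p)) (proj₂ (proj₁ q)) e))) (λ p → listed v₀ (toAy p))
            small : deg (E⁺ splitB⁻) (∁ B⁻ - b) x < length (L x)
            small = subst (deg (E⁺ splitB⁻) (∁ B⁻ - b) x <_) (sym (len x))
              (≤-trans (s≤s (size-mono (Nb (E⁺ splitB⁻) (∁ B⁻ - b) x) (Nb N (∁ B⁻ - b) x)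
                λ (e , p) → real (≢-sym b≢x) (proj₂ p) e , p)) (deg-miss (∁ B⁻ - b) x∼b (λ p → proj₂ p refl)))
            inU : ∀ {u} → Ay ∋ u → ∁ B⁻ ∋ u
            inU (inj₁ au) (((nu , _) , _) , _) = nu au
            inU (inj₂ refl) = Split.y∉R splitB⁻
            finish : ∀ {c d} → Valid (E⁺ splitB⁻) L (∁ B⁻) (θ₀ [ x ↦ c ] [ b ↦ d ]) → φ ≈ φ₀
            -- With the cut at {b , y} the invariant itself keeps b and y different, so K is empty.
            finish {c} {d} vθ = case lift-separated splitB⁻ (constB⁻ conB) (λ _ → ⊥) goodB⁻ V (nb , λ ()) vθ of λ
              (ψ , s , (ne , _) , agree) → s ◅◅ y-distinct (steps-valid V s)
                (λ q → target-A-distinct v₀ (trans (sym (at a≢x (≢-sym b≢a))) (trans (sym (agree (inU (inj₁ a∈A))))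
                  (trans q (trans (agree (inU (inj₂ refl))) (at (≢-sym x≢y) (≢-sym b≢y)))))))
                ne
              where
              at : ∀ {u} → u ≢ x → u ≢ b → (θ₀ [ x ↦ c ] [ b ↦ d ]) u ≡ θ₀ u
              at ux ub = trans (upd-other (θ₀ [ x ↦ c ]) ub) (upd-other θ₀ ux)

        constant-class : ∀ φ → Proper φ → φ ≈ φ₀
        constant-class φ V = case (φ a ≟ φ y) of λ
          { (yes qa) → case (φ b ≟ φ y) of λ
            { (yes qb) → equal-class V V₀ (trans qa (sym qb)) q₀
            ; (no nb) → y-like-a V qa nb }
          ; (no na) → case (φ b ≟ φ y) of λ
            { (yes qb) → y-like-b V na qb
            ; (no nb) → y-distinct V na nb } }

    one-class : ∃ λ φ₀ → Proper φ₀ × (∀ φ → Proper φ → φ ≈ φ₀)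
    one-class = case constant-or-loose A of λ
      { (inj₁ conA) → case constant-or-loose B of λ
        { (inj₁ conB) → case ConstantLists.base-colouring conA conB of λ
            (φ₀ , V₀ , q₀) → φ₀ , V₀ , ConstantLists.constant-class conA conB V₀ q₀
        ; (inj₂ (_ , _ , _ , l)) → conclude l (constantA-classes conA l) }
      ; (inj₂ la@(_ , _ , _ , l)) → case constant-or-loose B of λ
        { (inj₁ conB) → conclude l (constantB-classes conB)
        ; (inj₂ lb) → conclude l (both-loose-classes la lb) } }
      where
      conclude : ∀ {v c} → Loose v c → (∃ λ φ₀ → Proper φ₀ × Classes φ₀) → ∃ λ φ₀ → Proper φ₀ × (∀ φ → Proper φ → φ ≈ φ₀)
      conclude l (φ₀ , V₀ , classes) = φ₀ , V₀ , all-equivalent l classes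

theorem2 : (k : ℕ) → 3 ≤ k → (G : Graph) → Regular G k → Connectivity2 G → KSwappable G k
theorem2 k k≥3 G reg (n≥3 , _ , 2conn , x , y , x≢y , dis) L kL =
  case smallest-fragment G {proj₁ cut} (proj₂ cut) of λ (_ , x , _ , sf) →
  case Assignment.Cases.one-class G (twoConnected G 2conn) k (λ v → trans (deg-net G v) (reg v)) L (proj₁ ∘ kL) (proj₂ ∘ kL) k≥3 sf of λ
    (φ₀ , V₀ , all) → (φ₀ , isL G x V₀) , λ φ ψ vφ vψ →
      steps-swaps G x (all φ (toValid vφ) ◅◅ steps-inverse (all ψ (toValid vψ)))
  where
  cut : Σ[ A ∈ VSet (Graph.n G) ] Fragment G A x y
  cut = fragment-of-cut G x≢y dis
  toValid : ∀ {φ} → IsLColoring G L φ → Valid (net G) L Whole φ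
  toValid (pr , li) = valid (λ {u} {w} _ _ → pr u w) (λ {u} _ → li u)
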